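{- There exist absolute constants $c>0$ and $n_0$ such that for every integer $n\ge n_0$ and every $\varepsilon$ with $n^{ -1/3} < \varepsilon < 1/2$, there exists an $n$-point set $X \subset \mathbb{R}$ such that every simultaneous $\varepsilon$-coreset of $X$ for $p$-Centrum with $k=1$ has size at least $c\,\varepsilon^{ -1/2}\log n$.
   Context: For a finite multiset $Y\subset\mathbb{R}$ and a point $c\in\mathbb{R}$, $\mathrm{cost}_p(Y,c)$ is the sum of the $p$ largest values among $\{|y-c|\}_{y\in Y}$ (with multiplicity; the sum of all of them if $|Y|<p$). A coreset is a finite set of points with positive integer weights, viewed as a multiset; its size is the number of distinct points. A multiset $D\subset \mathbb{R}$ is a simultaneous $\varepsilon$-coreset of $X$ (with $|X|=n$) for $p$-Centrum with $k=1$ if for every $p\in\{1,\dots,n\}$ and every $c\in\mathbb{R}$, $(1-\varepsilon)\mathrm{cost}_p(X,c)\le\mathrm{cost}_p(D,c)\le(1+\varepsilon)\mathrm{cost}_p(X,c)$. -}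

module Defs where

open import Algebra.Bundles using (CommutativeRing)
open import Algebra.Core using (Op₁; Op₂)
open import Algebra.Structures using (IsCommutativeRing)
open import Data.List.Base using (List; length; map; concatMap; replicate; take; foldr)
open import Data.List.Relation.Unary.All using (All)
open import Data.Nat.Base as ℕ using (ℕ; zero; suc; NonZero; s≤s; z≤n)
import Data.Nat.Properties as ℕₚ
open import Data.Product.Base using (∃; ∃-syntax; _×_; _,_; proj₁; proj₂)
open import Data.Sum.Base using (_⊎_; inj₁; inj₂)
open import Level using (0ℓ)
open import Relation.Binary.Bundles using (DecTotalOrder)
open import Relation.Binary.Core using (Rel)
open import Relation.Binary.PropositionalEquality as ≡ using (_≡_)
open import Relation.Binary.Structures using (IsDecTotalOrder)
open import Relation.Nullary using (¬_; yes; no)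
open import Relation.Nullary.Negation using (contradiction)
open import Relation.Unary using (Pred)

import Algebra.Construct.NaturalChoice.Max as Max
import Algebra.Properties.Ring as RingProperties
import Algebra.Properties.Semiring.Exp as Exp
import Algebra.Properties.Semiring.Mult as Mult
import Data.List.Relation.Unary.Unique.Setoid as UniqueSetoid
import Data.List.Sort as Sort
import Relation.Binary.Construct.Flip.EqAndOrd as Flip
import Relation.Binary.Construct.NonStrictToStrict as ToStrict
import Relation.Binary.Reasoning.PartialOrder as PartialOrderReasoning

-- The real numbers, given by their usual axiomatic characterisation:
-- a Dedekind-complete totally ordered field is unique up to isomorphism.
record RealNumbers : Set₁ where
  infix  4 _≈_ _≤_
  infixl 6 _+_
  infixl 7 _*_
  infix  8 -_
  infix  9 _⁻¹
  field
    Carrier           : Set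
    _≈_ _≤_           : Rel Carrier 0ℓ
    _+_ _*_           : Op₂ Carrier
    -_                : Op₁ Carrier
    0# 1#             : Carrier
    -- Only constrained away from 0#.
    _⁻¹               : Op₁ Carrier
    isCommutativeRing : IsCommutativeRing _≈_ _+_ _*_ -_ 0# 1#
    isDecTotalOrder   : IsDecTotalOrder _≈_ _≤_
    1≉0               : ¬ (1# ≈ 0#)
    ⁻¹-inverseʳ       : ∀ x → ¬ (x ≈ 0#) → x * x ⁻¹ ≈ 1#
    +-monoʳ-≤         : ∀ x {y z} → y ≤ z → x + y ≤ x + z
    *-nonneg          : ∀ {x y} → 0# ≤ x → 0# ≤ y → 0# ≤ x * y

  UpperBound : Pred Carrier 0ℓ → Carrier → Set
  UpperBound P u = ∀ y → P y → y ≤ u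

  IsSupremum : Pred Carrier 0ℓ → Carrier → Set
  IsSupremum P s = UpperBound P s × (∀ u → UpperBound P u → s ≤ u)

  field
    complete : ∀ P → ∃ P → ∃ (UpperBound P) → ∃ (IsSupremum P)

  commutativeRing : CommutativeRing 0ℓ 0ℓ
  commutativeRing = record { isCommutativeRing = isCommutativeRing }

  decTotalOrder : DecTotalOrder 0ℓ 0ℓ 0ℓ
  decTotalOrder = record { isDecTotalOrder = isDecTotalOrder }

module RealArithmetic (ℝ : RealNumbers) where

  open RealNumbers ℝ public
    using ( Carrier; _⁻¹; 1≉0; ⁻¹-inverseʳ; +-monoʳ-≤; *-nonneg
          ; UpperBound; IsSupremum; complete
          ; commutativeRing; decTotalOrder )
  open CommutativeRing commutativeRing public
    hiding (Carrier; _-_)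
  open DecTotalOrder decTotalOrder public
    using (_≤_; _≤?_; total; poset; totalOrder)
    renaming (refl to ≤-refl; reflexive to ≤-reflexive; trans to ≤-trans; antisym to ≤-antisym; _≟_ to _≈?_)
  open ToStrict _≈_ _≤_ public using (_<_)
  open Max totalOrder public using (_⊔_; x≤x⊔y; x≤y⊔x)
  open Exp semiring public using (_^_)
  open Mult semiring using () renaming (_×_ to _×ℕ_)

  infixl 6 _-_
  _-_ : Op₂ Carrier
  x - y = x + (- y)

  fromℕ : ℕ → Carrier
  fromℕ n = n ×ℕ 1#

  ∣_∣ : Op₁ Carrier
  ∣ x ∣ = x ⊔ (- x)

  private
    module R = RingProperties ring
    module M = Mult semiring
    open PartialOrderReasoning poset

    ≤-shift : ∀ {x y} → x ≤ y → 0# ≤ y - x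
    ≤-shift {x} {y} x≤y = begin
      0#        ≈⟨ -‿inverseˡ x ⟨
      - x + x   ≤⟨ +-monoʳ-≤ (- x) x≤y ⟩
      - x + y   ≈⟨ +-comm (- x) y ⟩
      y - x     ∎

    ≤-unshift : ∀ {x y} → 0# ≤ y - x → x ≤ y
    ≤-unshift {x} {y} h = begin
      x             ≈⟨ +-identityʳ x ⟨
      x + 0#        ≤⟨ +-monoʳ-≤ x h ⟩
      x + (y - x)   ≈⟨ +-congˡ (+-comm y (- x)) ⟩
      x + (- x + y) ≈⟨ +-assoc x (- x) y ⟨
      x - x + y     ≈⟨ +-congʳ (-‿inverseʳ x) ⟩
      0# + y        ≈⟨ +-identityˡ y ⟩
      y             ∎

    *-monoˡ : ∀ {x y z} → 0# ≤ x → y ≤ z → x * y ≤ x * z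
    *-monoˡ {x} {y} {z} 0≤x y≤z = ≤-unshift (begin
      0#                ≤⟨ *-nonneg 0≤x (≤-shift y≤z) ⟩
      x * (z - y)       ≈⟨ distribˡ x z (- y) ⟩
      x * z + x * - y   ≈⟨ +-congˡ (R.-‿distribʳ-* x y) ⟨
      x * z - x * y     ∎)

    0≤1 : 0# ≤ 1#
    0≤1 with total 0# 1#
    ... | inj₁ h = h
    ... | inj₂ h = begin
      0#            ≤⟨ *-nonneg 0≤-1 0≤-1 ⟩
      - 1# * - 1#   ≈⟨ R.-‿distribˡ-* 1# (- 1#) ⟨
      - (1# * - 1#) ≈⟨ -‿cong (*-identityˡ (- 1#)) ⟩
      - (- 1#)      ≈⟨ R.-‿involutive 1# ⟩
      1#            ∎
      where
      0≤-1 : 0# ≤ - 1#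
      0≤-1 = begin
        0#        ≤⟨ ≤-shift h ⟩
        0# - 1#   ≈⟨ +-identityˡ (- 1#) ⟩
        - 1#      ∎

    1≤^ : ∀ {y} k → 1# ≤ y → 1# ≤ y ^ k
    ≤^  : ∀ {y} k → 1# ≤ y → y ≤ y ^ suc k
    1≤^ zero    _ = ≤-refl
    1≤^ (suc k) h = ≤-trans h (≤^ k h)
    ≤^ {y} k h = begin
      y          ≈⟨ *-identityʳ y ⟨
      y * 1#     ≤⟨ *-monoˡ (≤-trans 0≤1 h) (1≤^ k h) ⟩
      y * y ^ k  ∎

    fromℕ-mono : ∀ {m n} → m ℕ.≤ n → fromℕ m ≤ fromℕ n
    fromℕ-mono {n = zero}  z≤n = ≤-refl
    fromℕ-mono {n = suc n} z≤n = begin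
      0#             ≤⟨ 0≤1 ⟩
      1#             ≈⟨ +-identityʳ 1# ⟨
      1# + 0#        ≤⟨ +-monoʳ-≤ 1# (fromℕ-mono {n = n} z≤n) ⟩
      1# + fromℕ n   ∎
    fromℕ-mono (s≤s h) = +-monoʳ-≤ 1# (fromℕ-mono h)

    n<2^n : ∀ n → n ℕ.< 2 ℕ.^ n
    n<2^n zero    = s≤s z≤n
    n<2^n (suc n) = ℕₚ.≤-trans (ℕₚ.+-mono-≤ (ℕₚ.m^n>0 2 n) (n<2^n n))
      (ℕₚ.≤-reflexive (≡.cong (2 ℕ.^ n ℕ.+_) (≡.sym (ℕₚ.+-identityʳ (2 ℕ.^ n)))))

    exponent-bound : ∀ n p q → 2 ℕ.^ p ℕ.≤ n ℕ.^ q → p ℕ.≤ n ℕ.* q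
    exponent-bound n p q h with p ℕₚ.≤? n ℕ.* q
    ... | yes g = g
    ... | no  g = contradiction h (ℕₚ.<⇒≱ (ℕₚ.≤-<-trans
      (ℕₚ.≤-trans (ℕₚ.^-monoˡ-≤ q (ℕₚ.<⇒≤ (n<2^n n)))
                  (ℕₚ.≤-reflexive (ℕₚ.^-*-assoc 2 n q)))
      (ℕₚ.^-monoʳ-< 2 (s≤s (s≤s z≤n)) (ℕₚ.≰⇒> g))))

    root-bounded : ∀ k x → ∀ y → y ≈ 0# ⊎ (0# ≤ y × y ^ suc k ≤ x) → y ≤ 1# ⊔ x
    root-bounded k x y (inj₁ y≈0) = ≤-trans (≤-reflexive y≈0) (≤-trans 0≤1 (x≤x⊔y 1# x))
    root-bounded k x y (inj₂ (_ , yᵏ≤x)) with total 1# y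
    ... | inj₁ 1≤y = ≤-trans (≤^ k 1≤y) (≤-trans yᵏ≤x (x≤y⊔x 1# x))
    ... | inj₂ y≤1 = ≤-trans y≤1 (x≤x⊔y 1# x)

    quotient-bound : ∀ {y} n p q → 1 ℕ.≤ q → p ℕ.≤ n ℕ.* q → y * fromℕ q ≈ fromℕ p → y ≤ fromℕ n
    quotient-bound {y} n p q 1≤q p≤nq yq≈p with total y (fromℕ n)
    ... | inj₁ h = h
    ... | inj₂ h = ≤-unshift (begin
      0#                                        ≈⟨ -‿inverseʳ (N * Q) ⟨
      N * Q - N * Q                             ≤⟨ +-monoʳ-≤ (N * Q) -NQ≤-yQ ⟩
      N * Q - y * Q                             ≈⟨ factor N y Q ⟨
      (N - y) * Q                               ≤⟨ ≤-unshift (begin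
        0#                                      ≤⟨ *-nonneg (≤-shift h) (≤-shift 1≤Q) ⟩
        (y - N) * (Q - 1#)                      ≈⟨ flip-signs ⟩
        (N - y) - (N - y) * Q                   ∎) ⟩
      N - y                                     ∎)
      where
      N Q : Carrier
      N = fromℕ n
      Q = fromℕ q

      1≤Q : 1# ≤ Q
      1≤Q = ≤-trans (≤-reflexive (sym (+-identityʳ 1#))) (fromℕ-mono 1≤q)

      yQ≤NQ : y * Q ≤ N * Q
      yQ≤NQ = begin
        y * Q             ≈⟨ yq≈p ⟩
        fromℕ p           ≤⟨ fromℕ-mono p≤nq ⟩
        fromℕ (n ℕ.* q)   ≈⟨ M.×1-homo-* n q ⟩
        N * Q             ∎

      -NQ≤-yQ : - (N * Q) ≤ - (y * Q)
      -NQ≤-yQ = ≤-unshift (begin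
        0#                        ≤⟨ ≤-shift yQ≤NQ ⟩
        N * Q - y * Q             ≈⟨ +-comm _ _ ⟩
        - (y * Q) + N * Q         ≈⟨ +-congˡ (R.-‿involutive (N * Q)) ⟨
        - (y * Q) - (- (N * Q))   ∎)

      factor : ∀ a b c → (a - b) * c ≈ a * c - b * c
      factor a b c = trans (distribʳ c a (- b)) (+-congˡ (sym (R.-‿distribˡ-* b c)))

      neg-diff : ∀ a b → - (a - b) ≈ b - a
      neg-diff a b = trans (sym (R.-‿+-comm a (- b)))
        (trans (+-comm _ _) (+-congʳ (R.-‿involutive b)))

      flip-signs : (y - N) * (Q - 1#) ≈ (N - y) - (N - y) * Q
      flip-signs = begin-equality
        (y - N) * (Q - 1#)          ≈⟨ *-congʳ (neg-diff N y) ⟨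
        - (N - y) * (Q - 1#)        ≈⟨ R.-‿distribˡ-* (N - y) (Q - 1#) ⟨
        - ((N - y) * (Q - 1#))      ≈⟨ R.-‿distribʳ-* (N - y) (Q - 1#) ⟩
        (N - y) * - (Q - 1#)        ≈⟨ *-congˡ (neg-diff Q 1#) ⟩
        (N - y) * (1# - Q)          ≈⟨ distribˡ (N - y) 1# (- Q) ⟩
        (N - y) * 1# + (N - y) * - Q ≈⟨ +-cong (*-identityʳ (N - y)) (sym (R.-‿distribʳ-* (N - y) Q)) ⟩
        (N - y) - (N - y) * Q       ∎

  RootSet : ℕ → Carrier → Pred Carrier 0ℓ
  RootSet k x y = y ≈ 0# ⊎ (0# ≤ y × y ^ k ≤ x)

  root-sup : ∀ k .{{_ : NonZero k}} x → ∃ (IsSupremum (RootSet k x))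
  root-sup (suc k) x = complete (RootSet (suc k) x)
    (0# , inj₁ refl) (1# ⊔ x , root-bounded k x)

  -- The real k-th root: sup { y ≥ 0 ∣ yᵏ ≤ x } for x ≥ 0, and 0 for x < 0
  -- (the disjunct y ≈ 0# keeps the set inhabited there).
  root : ∀ k .{{_ : NonZero k}} → Op₁ Carrier
  root k x = proj₁ (root-sup k x)

  Log₂Set : ℕ → Pred Carrier 0ℓ
  Log₂Set n y = y ≈ 0# ⊎
    ∃[ p ] ∃[ q ] 1 ℕ.≤ q × y * fromℕ q ≈ fromℕ p × 2 ℕ.^ p ℕ.≤ n ℕ.^ q

  log₂-sup : ∀ n → ∃ (IsSupremum (Log₂Set n))
  log₂-sup n = complete (Log₂Set n) (0# , inj₁ refl) (fromℕ n , bounded)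
    where
    bounded : UpperBound (Log₂Set n) (fromℕ n)
    bounded y (inj₁ y≈0) = ≤-trans (≤-reflexive y≈0) (fromℕ-mono {n = n} z≤n)
    bounded y (inj₂ (p , q , 1≤q , yq≈p , h)) =
      quotient-bound n p q 1≤q (exponent-bound n p q h) yq≈p

  -- The real number log₂ n = sup { p / q ∣ 2ᵖ ≤ n^q } for n ≥ 1 (p ≥ 0 suffices
  -- because log₂ n ≥ 0), with the convention log₂ 0 = 0.
  log₂ : ℕ → Carrier
  log₂ n = proj₁ (log₂-sup n)

module Centrum (ℝ : RealNumbers) where

  open RealArithmetic ℝ public
  open UniqueSetoid setoid public using (Unique)
  open Sort (Flip.decTotalOrder decTotalOrder) using () renaming (sort to sortDescending)

  sum : List Carrier → Carrier
  sum = foldr _+_ 0#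

  -- Finite multisets of reals are lists; cost does not depend on their order.
  cost : ℕ → List Carrier → Carrier → Carrier
  cost p Y c = sum (take p (sortDescending (map (λ y → ∣ y - c ∣) Y)))

  record WeightedSet : Set where
    field
      points   : List (Carrier × ℕ)
      distinct : Unique (map proj₁ points)
      positive : All (λ (_ , w) → 1 ℕ.≤ w) points

    size : ℕ
    size = length points

    multiset : List Carrier
    multiset = concatMap (λ (x , w) → replicate w x) points

  open WeightedSet public using (size; multiset)

  IsSimultaneousCoreset : Carrier → List Carrier → WeightedSet → Set
  IsSimultaneousCoreset ε X D =
    ∀ p → 1 ℕ.≤ p → p ℕ.≤ length X → ∀ c →
      (1# - ε) * cost p X c ≤ cost p (multiset D) c ×
      cost p (multiset D) c ≤ (1# + ε) * cost p X c

{-# OPTIONS --safe #-}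

-- Take X = { √(i+1) − √i : i < n }, a set independent of ε, and look only at the centre 0: the p
-- largest elements of X sum to √p. For a coreset D, the sum G(p) of its p largest distances to 0
-- is affine in p wherever consecutive distances agree, and G must stay within a factor 1 ± ε of
-- √p. Since √ lies above its chord from k² to q² by a relative amount of order (q/k − 1)² at a
-- suitable middle point l², G cannot be affine between k² and q² once q/k ≥ 1 + C√ε; hence the
-- distances strictly drop there. About ε^(-1/2) log n such intervals fit one after the other
-- into [1, n], and each of them uses up a distance value, hence a point, of D.
module Submission where

open import Defs
open import Data.List.Base using (List; []; _∷_; length; map; take; applyUpTo; filter; replicate; concatMap)
open import Data.List.Membership.Propositional using (_∈_)
open import Data.List.Relation.Binary.Pointwise using (Pointwise; []; _∷_)
open import Data.List.Relation.Unary.All as All using (All; []; _∷_)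
open import Data.List.Relation.Unary.Any using (here; there)
open import Data.List.Relation.Unary.Linked using (Linked; []; [-]; _∷_)
open import Data.Nat.Base as ℕ using (ℕ; zero; suc; s≤s; z≤n)
open import Data.Product.Base using (_×_; _,_; proj₁; proj₂; Σ-syntax; ∃-syntax)
open import Data.Sum.Base using (inj₁; inj₂)
open import Relation.Binary.PropositionalEquality.Core as ≡ using (_≡_)
open import Relation.Nullary using (¬_; yes; no)
open import Relation.Nullary.Negation using (contradiction)
open import Relation.Unary using (Decidable)
import Algebra.Construct.NaturalChoice.Max as Max
import Algebra.Properties.Ring as RingProperties
import Algebra.Properties.Semiring.Mult as Mult
import Algebra.Solver.Ring.NaturalCoefficients.Default as Solver
import Data.List.Membership.Propositional.Properties as ∈ₚ
import Data.List.Properties as Listₚ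
import Data.List.Relation.Binary.Permutation.Propositional as Perm
import Data.List.Relation.Binary.Permutation.Propositional.Properties as Permₚ
import Data.List.Relation.Unary.All.Properties as Allₚ
import Data.List.Relation.Unary.Sorted.TotalOrder.Properties as Sortedₚ
import Data.List.Relation.Unary.Unique.Setoid.Properties as Uniqueₚ
import Data.List.Sort as Sort
import Data.List.Sort.Base as SortBase
import Data.Nat.Properties as ℕₚ
import Data.Nat.Solver as ℕSolver
import Relation.Binary.Bundles as Bundles
import Relation.Binary.Construct.Flip.EqAndOrd as Flip
import Relation.Binary.Reasoning.PartialOrder as PartialOrderReasoning

open ℕSolver.+-*-Solver using ()
  renaming (solve to ℕsolve; con to conℕ; _:=_ to _:=ℕ_; _:+_ to _:+ℕ_; _:*_ to _:*ℕ_)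

-- Sampling the cost at squares p = k² makes √p an integer, so every comparison of √ with its chords
-- becomes an identity between natural numbers. Likewise ε is traded for an integer w with 128εw² ≤
-- 1 < 128ε(w+1)², of order ε^(-1/2). On the scale of k, a window needs three integer nodes with
-- relative spacing about 1/w, which pushes the first node up to order w. This is where ε > n^(-1/3)
-- enters: it keeps w below n^(1/6), so the windows between w and √n still cover a constant fraction
-- of log n. When ε is so large that w = 0, windows of fixed ratio 64 take over.

-- Natural-number estimates: scales, blocks and constants.

module Arithmetic where

  open import Data.Nat.Base using (_+_; _*_; _^_; _≤_; _<_)
  open ℕₚ.≤-Reasoning

  -- Descending from N, the first hit automatically has a failing successor, so `P` may be any
  -- decidable property, monotone or not.
  bounded-search : ∀ {P : ℕ → Set} → Decidable P → ∀ N → P 0 → ¬ P N → ∃[ w ] P w × ¬ P (suc w)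
  bounded-search P? zero    p0 ¬p0 = contradiction p0 ¬p0
  bounded-search P? (suc N) p0 ¬pN with P? N
  ... | yes pN  = N , pN , ¬pN
  ... | no  ¬pN′ = bounded-search P? N p0 ¬pN′

  n<2^n : ∀ n → n < 2 ^ n
  n<2^n zero    = s≤s z≤n
  n<2^n (suc n) = begin-strict
    1 + n           <⟨ ℕₚ.+-monoʳ-< 1 (n<2^n n) ⟩
    1 + 2 ^ n       ≤⟨ ℕₚ.+-monoˡ-≤ (2 ^ n) (ℕₚ.m^n>0 2 n) ⟩
    2 ^ n + 2 ^ n   ≡⟨ ≡.cong (2 ^ n +_) (ℕₚ.+-identityʳ (2 ^ n)) ⟨
    2 * 2 ^ n       ∎

  square-mono-≤ : ∀ {m n} → m ≤ n → m * m ≤ n * n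
  square-mono-≤ m≤n = ℕₚ.*-mono-≤ m≤n m≤n

  square-cancel-≤ : ∀ {m n} → m * m ≤ n * n → m ≤ n
  square-cancel-≤ m²≤n² = ℕₚ.≮⇒≥ λ n<m → ℕₚ.<⇒≱ (ℕₚ.*-mono-< n<m n<m) m²≤n²

  -- A crude bound whose purpose is to give the search in `last-scale` a scale that certainly
  -- exceeds n.
  n<[a*b^n]² : ∀ {a b} n → 1 ≤ a → 2 ≤ b → n < a * b ^ n * (a * b ^ n)
  n<[a*b^n]² {a} {b} n 1≤a 2≤b = begin-strict
    n                       <⟨ n<2^n n ⟩
    2 ^ n                   ≤⟨ ℕₚ.^-monoˡ-≤ n 2≤b ⟩
    b ^ n                   ≤⟨ ℕₚ.m≤n*m (b ^ n) a ⟩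
    a * b ^ n               ≤⟨ ℕₚ.m≤n*m (a * b ^ n) (a * b ^ n) ⟩
    a * b ^ n * (a * b ^ n) ∎
    where
    instance
      a-nonZero : ℕ.NonZero a
      a-nonZero = ℕ.>-nonZero 1≤a
      b-nonZero : ℕ.NonZero b
      b-nonZero = ℕ.>-nonZero (ℕₚ.<⇒≤ 2≤b)
      ab^n-nonZero : ℕ.NonZero (a * b ^ n)
      ab^n-nonZero = ℕ.>-nonZero (ℕₚ.*-mono-≤ 1≤a (ℕₚ.m^n>0 b n))

  module _ (r : ℕ → ℕ) (n B k₀ m : ℕ) (1≤B : 1 ≤ B)
    (block : ∀ d → 1 ≤ d → B * (k₀ * d) * (B * (k₀ * d)) ≤ n →
             m + r (B * (k₀ * d)) ≤ r (k₀ * d)) where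

    -- Consecutive blocks share an endpoint, so their losses telescope. Later `r` is a count of
    -- coreset points, and each factor `B` in k uses up `m` of them.
    iterate-block : ∀ S → k₀ * B ^ S * (k₀ * B ^ S) ≤ n → S * m + r (k₀ * B ^ S) ≤ r (k₀ * 1)
    iterate-block zero    _    = ℕₚ.≤-refl
    iterate-block (suc S) q²≤n = begin
      m + S * m + r (k₀ * (B * B ^ S)) ≡⟨ ≡.cong (λ q → m + S * m + r q) q≡ ⟩
      m + S * m + r (B * k)            ≡⟨ ℕsolve 3 (λ a b c → (a :+ℕ b) :+ℕ c :=ℕ b :+ℕ (a :+ℕ c)) ≡.refl m (S * m) _ ⟩
      S * m + (m + r (B * k))          ≤⟨ ℕₚ.+-monoʳ-≤ (S * m) (block (B ^ S) (ℕₚ.m^n>0 B S)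
                                            (≡.subst (λ q → q * q ≤ n) q≡ q²≤n)) ⟩
      S * m + r k                      ≤⟨ iterate-block S (ℕₚ.≤-trans (square-mono-≤ k≤q) q²≤n) ⟩
      r (k₀ * 1)                       ∎
      where
      instance
        B-nonZero : ℕ.NonZero B
        B-nonZero = ℕ.>-nonZero 1≤B
      k = k₀ * B ^ S
      q≡ : k₀ * (B * B ^ S) ≡ B * k
      q≡ = ℕsolve 3 (λ a b c → a :*ℕ (b :*ℕ c) :=ℕ b :*ℕ (a :*ℕ c)) ≡.refl k₀ B (B ^ S)
      k≤q : k ≤ k₀ * (B * B ^ S)
      k≤q = ℕₚ.*-monoʳ-≤ k₀ (ℕₚ.m≤n*m (B ^ S) B)

  -- If u = 128w² and u³ ≤ n ≤ (2w·2ˢ)², then n³ ≤ u³ 4³ˢ ≤ n 4³ˢ, so n ≤ 8ˢ.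
  n≤2^[S*3] : ∀ {n} w S → let u = 128 * (w * w) in 1 ≤ n → u * u * u ≤ n →
    n ≤ 2 * w * 2 ^ S * (2 * w * 2 ^ S) → n ≤ 2 ^ (S * 3)
  n≤2^[S*3] {n} w S 1≤n u³≤n n≤ = ≡.subst (n ≤_) (ℕₚ.^-*-assoc 2 S 3)
    (square-cancel-≤ (ℕₚ.*-cancelˡ-≤ n {{ℕ.>-nonZero 1≤n}} (begin
      n * (n * n)                             ≤⟨ ℕₚ.*-mono-≤ n≤uz² (ℕₚ.*-mono-≤ n≤uz² n≤uz²) ⟩
      u * (z * z) * (u * (z * z) * (u * (z * z))) ≡⟨ ℕsolve 2 (λ u z →
        u :*ℕ (z :*ℕ z) :*ℕ (u :*ℕ (z :*ℕ z) :*ℕ (u :*ℕ (z :*ℕ z))) :=ℕ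
        u :*ℕ u :*ℕ u :*ℕ ((z :*ℕ (z :*ℕ (z :*ℕ conℕ 1))) :*ℕ (z :*ℕ (z :*ℕ (z :*ℕ conℕ 1))))) ≡.refl u z ⟩
      u * u * u * (z ^ 3 * z ^ 3)             ≤⟨ ℕₚ.*-monoˡ-≤ (z ^ 3 * z ^ 3) u³≤n ⟩
      n * (z ^ 3 * z ^ 3)                     ∎)))
    where
    u = 128 * (w * w)
    z = 2 ^ S
    n≤uz² : n ≤ u * (z * z)
    n≤uz² = begin
      n                         ≤⟨ n≤ ⟩
      2 * w * z * (2 * w * z)   ≡⟨ ℕsolve 2 (λ w z → conℕ 2 :*ℕ w :*ℕ z :*ℕ (conℕ 2 :*ℕ w :*ℕ z) :=ℕ
                                     conℕ 4 :*ℕ (w :*ℕ w) :*ℕ (z :*ℕ z)) ≡.refl w z ⟩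
      4 * (w * w) * (z * z)     ≤⟨ ℕₚ.*-monoˡ-≤ (z * z) (ℕₚ.*-monoˡ-≤ (w * w) {4} {128} (ℕₚ.m≤m+n 4 124)) ⟩
      u * (z * z)               ∎

  -- The exponent is shifted by one so that at least one block fits. With T + 1 blocks inside the
  -- range and T + 2 covering it, rounding costs at most a factor 2 in the logarithm.
  last-scale : ∀ a b n → 1 ≤ a → 2 ≤ b → a * b ^ 1 * (a * b ^ 1) ≤ n →
    ∃[ T ] a * b ^ suc T * (a * b ^ suc T) ≤ n × n ≤ a * b ^ suc (suc T) * (a * b ^ suc (suc T))
  last-scale a b n 1≤a 2≤b start =
    let T , reached , unreached = bounded-search (λ T → a * b ^ suc T * (a * b ^ suc T) ℕₚ.≤? n) n start
          (ℕₚ.<⇒≱ (ℕₚ.<-trans (ℕₚ.n<1+n n) (n<[a*b^n]² (suc n) 1≤a 2≤b)))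
    in T , reached , ℕₚ.≰⇒≥ unreached

  [1*b^m]²≡2^[em+em] : ∀ {b} e m → b ≡ 2 ^ e → 1 * b ^ m * (1 * b ^ m) ≡ 2 ^ (e * m + e * m)
  [1*b^m]²≡2^[em+em] {b} e m ≡.refl = ≡.trans (≡.cong₂ _*_ b^m b^m) (≡.sym (ℕₚ.^-distribˡ-+-* 2 (e * m) (e * m)))
    where
    b^m : 1 * b ^ m ≡ 2 ^ (e * m)
    b^m = ≡.trans (ℕₚ.*-identityˡ (b ^ m)) (ℕₚ.^-*-assoc 2 e m)

  -- Combined with u³ ≤ n, this makes room for the first doubling block, which starts at 2w.
  [2w*2^1]²≤u³ : ∀ {w} → 1 ≤ w → let u = 128 * (w * w) in 2 * w * 2 ^ 1 * (2 * w * 2 ^ 1) ≤ u * u * u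
  [2w*2^1]²≤u³ {w} 1≤w = begin
    2 * w * 2 ^ 1 * (2 * w * 2 ^ 1) ≡⟨ ℕsolve 1 (λ w → conℕ 2 :*ℕ w :*ℕ conℕ 2 :*ℕ (conℕ 2 :*ℕ w :*ℕ conℕ 2) :=ℕ
                                         conℕ 16 :*ℕ (w :*ℕ w)) ≡.refl w ⟩
    16 * (w * w)                    ≤⟨ ℕₚ.*-monoˡ-≤ (w * w) {16} {128} (ℕₚ.m≤m+n 16 112) ⟩
    u                               ≤⟨ ℕₚ.m≤n*m u (u * u) {{ℕ.>-nonZero (ℕₚ.*-mono-≤ 1≤u 1≤u)}} ⟩
    u * u * u                       ∎
    where
    u = 128 * (w * w)
    1≤u : 1 ≤ u
    1≤u = ℕₚ.≤-trans (ℕₚ.*-mono-≤ 1≤w 1≤w) (ℕₚ.m≤m+n (w * w) _)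

  -- Since w + 1 ≤ 2w, the left side is at most 512w², and 23 is the least integer whose square
  -- reaches 512.
  128[1+w]²≤[23w]² : ∀ {w} → 1 ≤ w → 128 * (suc w * suc w) ≤ 23 * w * (23 * w)
  128[1+w]²≤[23w]² {suc v} _ = ℕₚ.≤-trans (ℕₚ.m≤m+n _ (401 * (v * v) + 546 * v + 17)) (ℕₚ.≤-reflexive (ℕsolve 1 (λ v →
    conℕ 128 :*ℕ ((conℕ 2 :+ℕ v) :*ℕ (conℕ 2 :+ℕ v)) :+ℕ (conℕ 401 :*ℕ (v :*ℕ v) :+ℕ conℕ 546 :*ℕ v :+ℕ conℕ 17) :=ℕ
    conℕ 23 :*ℕ (conℕ 1 :+ℕ v) :*ℕ (conℕ 23 :*ℕ (conℕ 1 :+ℕ v))) ≡.refl v))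

  -- Origin of 288: here 12 bounds √(1/ε), the sum 6(T+2) + 6(T+2) bounds log₂ n, and T + 1 drops
  -- are available. Equality holds at T = 0.
  coarse-constant : ∀ T → 12 * (6 * suc (suc T) + 6 * suc (suc T)) ≤ 288 * (suc T * 1)
  coarse-constant T = ℕₚ.≤-trans (ℕₚ.m≤m+n _ (144 * T)) (ℕₚ.≤-reflexive (ℕsolve 1 (λ T →
    conℕ 12 :*ℕ (conℕ 6 :*ℕ (conℕ 2 :+ℕ T) :+ℕ conℕ 6 :*ℕ (conℕ 2 :+ℕ T)) :+ℕ conℕ 144 :*ℕ T :=ℕ
    conℕ 288 :*ℕ ((conℕ 1 :+ℕ T) :*ℕ conℕ 1)) ≡.refl T))

  fine-constant : ∀ T w → 23 * w * (suc (suc T) * 3) ≤ 288 * (suc T * w)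
  fine-constant T w = ℕₚ.≤-trans (ℕₚ.m≤m+n _ (150 * w + 219 * (T * w))) (ℕₚ.≤-reflexive (ℕsolve 2 (λ T w →
    conℕ 23 :*ℕ w :*ℕ ((conℕ 2 :+ℕ T) :*ℕ conℕ 3) :+ℕ (conℕ 150 :*ℕ w :+ℕ conℕ 219 :*ℕ (T :*ℕ w)) :=ℕ
    conℕ 288 :*ℕ ((conℕ 1 :+ℕ T) :*ℕ w)) ≡.refl T w))

-- Consequences of the ordered field axioms.

module OrderedField (ℝ : RealNumbers) where

  open RealArithmetic ℝ
  open PartialOrderReasoning poset
  private
    module R = RingProperties ring
    module M = Mult semiring
  open Solver commutativeSemiring

  ≰⇒< : ∀ {x y} → ¬ (y ≤ x) → x < y
  ≰⇒< {x} {y} y≰x with total x y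
  ... | inj₁ x≤y = x≤y , λ x≈y → y≰x (≤-reflexive (sym x≈y))
  ... | inj₂ y≤x = contradiction y≤x y≰x

  <⇒≱ : ∀ {x y} → x < y → ¬ (y ≤ x)
  <⇒≱ (x≤y , x≉y) y≤x = x≉y (≤-antisym x≤y y≤x)

  ≮⇒≥ : ∀ {x y} → ¬ (x < y) → y ≤ x
  ≮⇒≥ {x} {y} x≮y with y ≤? x
  ... | yes y≤x = y≤x
  ... | no  y≰x = contradiction (≰⇒< y≰x) x≮y

  <-≤-trans : ∀ {x y z} → x < y → y ≤ z → x < z
  <-≤-trans x<y y≤z = ≰⇒< λ z≤x → <⇒≱ x<y (≤-trans y≤z z≤x)

  ≤-<-trans : ∀ {x y z} → x ≤ y → y < z → x < z
  ≤-<-trans x≤y y<z = ≰⇒< λ z≤x → <⇒≱ y<z (≤-trans z≤x x≤y)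

  +-monoˡ-≤ : ∀ x {y z} → y ≤ z → y + x ≤ z + x
  +-monoˡ-≤ x {y} {z} y≤z = begin
    y + x ≈⟨ +-comm y x ⟩
    x + y ≤⟨ +-monoʳ-≤ x y≤z ⟩
    x + z ≈⟨ +-comm x z ⟩
    z + x ∎

  +-mono-≤ : ∀ {x y u v} → x ≤ y → u ≤ v → x + u ≤ y + v
  +-mono-≤ {y = y} {u = u} x≤y u≤v = ≤-trans (+-monoˡ-≤ u x≤y) (+-monoʳ-≤ y u≤v)

  x≈-z+[z+x] : ∀ z x → x ≈ - z + (z + x)
  x≈-z+[z+x] z x = sym (trans (sym (+-assoc (- z) z x))
    (trans (+-congʳ (-‿inverseˡ z)) (+-identityˡ x)))

  +-cancelˡ-≤ : ∀ z {x y} → z + x ≤ z + y → x ≤ y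
  +-cancelˡ-≤ z {x} {y} h = begin
    x             ≈⟨ x≈-z+[z+x] z x ⟩
    - z + (z + x) ≤⟨ +-monoʳ-≤ (- z) h ⟩
    - z + (z + y) ≈⟨ x≈-z+[z+x] z y ⟨
    y             ∎

  x+[y-x]≈y : ∀ x y → x + (y - x) ≈ y
  x+[y-x]≈y x y = trans (+-congˡ (+-comm y (- x)))
    (trans (sym (+-assoc x (- x) y)) (trans (+-congʳ (-‿inverseʳ x)) (+-identityˡ y)))

  x≤y⇒0≤y-x : ∀ {x y} → x ≤ y → 0# ≤ y - x
  x≤y⇒0≤y-x {x} {y} x≤y = +-cancelˡ-≤ x (begin
    x + 0#      ≈⟨ +-identityʳ x ⟩
    x           ≤⟨ x≤y ⟩
    y           ≈⟨ x+[y-x]≈y x y ⟨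
    x + (y - x) ∎)

  x≤x+y : ∀ x {y} → 0# ≤ y → x ≤ x + y
  x≤x+y x {y} 0≤y = begin
    x      ≈⟨ +-identityʳ x ⟨
    x + 0# ≤⟨ +-monoʳ-≤ x 0≤y ⟩
    x + y  ∎

  *-monoˡ-≤ : ∀ {x y z} → 0# ≤ x → y ≤ z → x * y ≤ x * z
  *-monoˡ-≤ {x} {y} {z} 0≤x y≤z = begin
    x * y               ≤⟨ x≤x+y (x * y) (*-nonneg 0≤x (x≤y⇒0≤y-x y≤z)) ⟩
    x * y + x * (z - y) ≈⟨ distribˡ x y (z - y) ⟨
    x * (y + (z - y))   ≈⟨ *-congˡ (x+[y-x]≈y y z) ⟩
    x * z               ∎

  *-monoʳ-≤ : ∀ {x y z} → 0# ≤ x → y ≤ z → y * x ≤ z * x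
  *-monoʳ-≤ {x} {y} {z} 0≤x y≤z = begin
    y * x ≈⟨ *-comm y x ⟩
    x * y ≤⟨ *-monoˡ-≤ 0≤x y≤z ⟩
    x * z ≈⟨ *-comm x z ⟩
    z * x ∎

  *-mono-≤ : ∀ {x y u v} → 0# ≤ x → 0# ≤ u → x ≤ y → u ≤ v → x * u ≤ y * v
  *-mono-≤ {y = y} 0≤x 0≤u x≤y u≤v =
    ≤-trans (*-monoʳ-≤ 0≤u x≤y) (*-monoˡ-≤ (≤-trans 0≤x x≤y) u≤v)

  x≤0⇒0≤-x : ∀ {x} → x ≤ 0# → 0# ≤ - x
  x≤0⇒0≤-x {x} x≤0 = begin
    0#     ≤⟨ x≤y⇒0≤y-x x≤0 ⟩
    0# - x ≈⟨ +-identityˡ (- x) ⟩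
    - x    ∎

  0≤x*x : ∀ x → 0# ≤ x * x
  0≤x*x x with total 0# x
  ... | inj₁ 0≤x = *-nonneg 0≤x 0≤x
  ... | inj₂ x≤0 = begin
    0#            ≤⟨ *-nonneg (x≤0⇒0≤-x x≤0) (x≤0⇒0≤-x x≤0) ⟩
    - x * - x     ≈⟨ R.-‿distribˡ-* x (- x) ⟨
    - (x * - x)   ≈⟨ -‿cong (R.-‿distribʳ-* x x) ⟨
    - (- (x * x)) ≈⟨ R.-‿involutive (x * x) ⟩
    x * x         ∎

  0≤1 : 0# ≤ 1#
  0≤1 = ≤-trans (0≤x*x 1#) (≤-reflexive (*-identityˡ 1#))

  0<1 : 0# < 1#
  0<1 = 0≤1 , λ 0≈1 → 1≉0 (sym 0≈1)

  0<⇒≉0 : ∀ {x} → 0# < x → ¬ (x ≈ 0#)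
  0<⇒≉0 (_ , 0≉x) x≈0 = 0≉x (sym x≈0)

  ⁻¹-nonneg : ∀ {x} → 0# < x → 0# ≤ x ⁻¹
  ⁻¹-nonneg {x} 0<x@(0≤x , _) = ≮⇒≥ λ (x⁻¹≤0 , _) → <⇒≱ 0<1 (+-cancelˡ-≤ 0# (begin
    0# + 1#            ≤⟨ +-monoˡ-≤ 1# (*-nonneg 0≤x (x≤0⇒0≤-x x⁻¹≤0)) ⟩
    x * - (x ⁻¹) + 1#  ≈⟨ +-congʳ (R.-‿distribʳ-* x (x ⁻¹)) ⟨
    - (x * x ⁻¹) + 1#  ≈⟨ +-congʳ (-‿cong (⁻¹-inverseʳ x (0<⇒≉0 0<x))) ⟩
    - 1# + 1#          ≈⟨ -‿inverseˡ 1# ⟩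
    0#                 ≈⟨ +-identityˡ 0# ⟨
    0# + 0#            ∎))

  x⁻¹*[x*y]≈y : ∀ {x} y → 0# < x → x ⁻¹ * (x * y) ≈ y
  x⁻¹*[x*y]≈y {x} y 0<x = begin-equality
    x ⁻¹ * (x * y) ≈⟨ *-assoc (x ⁻¹) x y ⟨
    x ⁻¹ * x * y   ≈⟨ *-congʳ (*-comm (x ⁻¹) x) ⟩
    x * x ⁻¹ * y   ≈⟨ *-congʳ (⁻¹-inverseʳ x (0<⇒≉0 0<x)) ⟩
    1# * y         ≈⟨ *-identityˡ y ⟩
    y              ∎

  *-cancelˡ-≤ : ∀ {x y z} → 0# < x → x * y ≤ x * z → y ≤ z
  *-cancelˡ-≤ {x} {y} {z} 0<x h = begin
    y              ≈⟨ x⁻¹*[x*y]≈y y 0<x ⟨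
    x ⁻¹ * (x * y) ≤⟨ *-monoˡ-≤ (⁻¹-nonneg 0<x) h ⟩
    x ⁻¹ * (x * z) ≈⟨ x⁻¹*[x*y]≈y z 0<x ⟩
    z              ∎

  ⁻¹-pos : ∀ {x} → 0# < x → 0# < x ⁻¹
  ⁻¹-pos {x} 0<x = ⁻¹-nonneg 0<x , λ 0≈x⁻¹ → 1≉0 (begin-equality
    1#       ≈⟨ ⁻¹-inverseʳ x (0<⇒≉0 0<x) ⟨
    x * x ⁻¹ ≈⟨ *-congˡ 0≈x⁻¹ ⟨
    x * 0#   ≈⟨ zeroʳ x ⟩
    0#       ∎)

  x*y≤1⇒x≤y⁻¹ : ∀ {x y} → 0# < y → x * y ≤ 1# → x ≤ y ⁻¹
  x*y≤1⇒x≤y⁻¹ {x} {y} 0<y h = *-cancelˡ-≤ 0<y (begin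
    y * x    ≈⟨ *-comm y x ⟩
    x * y    ≤⟨ h ⟩
    1#       ≈⟨ ⁻¹-inverseʳ y (0<⇒≉0 0<y) ⟨
    y * y ⁻¹ ∎)

  1≤x*y⇒y⁻¹≤x : ∀ {x y} → 0# < y → 1# ≤ x * y → y ⁻¹ ≤ x
  1≤x*y⇒y⁻¹≤x {x} {y} 0<y h = *-cancelˡ-≤ 0<y (begin
    y * y ⁻¹ ≈⟨ ⁻¹-inverseʳ y (0<⇒≉0 0<y) ⟩
    1#       ≤⟨ h ⟩
    x * y    ≈⟨ *-comm x y ⟩
    y * x    ∎)

  square-cancel-≤ : ∀ {x y} → 0# ≤ y → x * x ≤ y * y → x ≤ y
  square-cancel-≤ {x} {y} 0≤y x²≤y² = ≮⇒≥ λ y<x → <⇒≱ y<x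
    (*-cancelˡ-≤ (≤-<-trans 0≤y y<x) (≤-trans x²≤y² (*-monoʳ-≤ 0≤y (proj₁ y<x))))

  square-injective : ∀ {x y} → 0# ≤ x → 0# ≤ y → x * x ≈ y * y → x ≈ y
  square-injective 0≤x 0≤y x²≈y² = ≤-antisym
    (square-cancel-≤ 0≤y (≤-reflexive x²≈y²))
    (square-cancel-≤ 0≤x (≤-reflexive (sym x²≈y²)))

  -- With x = y + d the two sides differ by d². The substitution also removes subtraction, so that a
  -- semiring solver can check the identity.
  4xy≤[x+y]² : ∀ x y → (x * y + x * y) + (x * y + x * y) ≤ (x + y) * (x + y)
  4xy≤[x+y]² x y = begin
    (x * y + x * y) + (x * y + x * y)         ≈⟨ +-cong (+-cong xy≈ xy≈) (+-cong xy≈ xy≈) ⟩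
    (z * y + z * y) + (z * y + z * y)         ≤⟨ x≤x+y _ (0≤x*x d) ⟩
    (z * y + z * y) + (z * y + z * y) + d * d ≈⟨ solve 2 (λ y d →
      (((y :+ d) :* y :+ (y :+ d) :* y) :+ ((y :+ d) :* y :+ (y :+ d) :* y)) :+ d :* d :=
      (y :+ d :+ y) :* (y :+ d :+ y)) refl y d ⟩
    (z + y) * (z + y)                         ≈⟨ *-cong (+-congʳ x≈) (+-congʳ x≈) ⟨
    (x + y) * (x + y)                         ∎
    where
    d = x - y
    z = y + d
    x≈ : x ≈ z
    x≈ = sym (x+[y-x]≈y y x)
    xy≈ : x * y ≈ z * y
    xy≈ = *-congʳ x≈

  fromℕ-homo-+ : ∀ m n → fromℕ (m ℕ.+ n) ≈ fromℕ m + fromℕ n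
  fromℕ-homo-+ = M.×-homo-+ 1#

  fromℕ-homo-* : ∀ m n → fromℕ (m ℕ.* n) ≈ fromℕ m * fromℕ n
  fromℕ-homo-* = M.×1-homo-*

  fromℕ-cong : ∀ {m n} → m ≡ n → fromℕ m ≈ fromℕ n
  fromℕ-cong m≡n = reflexive (≡.cong fromℕ m≡n)

  fromℕ-nonneg : ∀ n → 0# ≤ fromℕ n
  fromℕ-nonneg zero    = ≤-refl
  fromℕ-nonneg (suc n) = ≤-trans 0≤1 (x≤x+y 1# (fromℕ-nonneg n))

  fromℕ-mono-≤ : ∀ {m n} → m ℕ.≤ n → fromℕ m ≤ fromℕ n
  fromℕ-mono-≤ {n = n} z≤n = fromℕ-nonneg n
  fromℕ-mono-≤ (s≤s m≤n)   = +-monoʳ-≤ 1# (fromℕ-mono-≤ m≤n)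

  fromℕ-1 : fromℕ 1 ≈ 1#
  fromℕ-1 = +-identityʳ 1#

  fromℕ-pos : ∀ {n} → 1 ℕ.≤ n → 0# < fromℕ n
  fromℕ-pos 1≤n = <-≤-trans 0<1 (≤-trans (≤-reflexive (sym fromℕ-1)) (fromℕ-mono-≤ 1≤n))

  fromℕ-cancel-≤ : ∀ {m n} → fromℕ m ≤ fromℕ n → m ℕ.≤ n
  fromℕ-cancel-≤ {m} {n} m≤n = ℕₚ.≮⇒≥ λ n<m → <⇒≱ 0<1 (+-cancelˡ-≤ (fromℕ n) (begin
    fromℕ n + 1#   ≈⟨ +-comm (fromℕ n) 1# ⟩
    fromℕ (suc n)  ≤⟨ fromℕ-mono-≤ n<m ⟩
    fromℕ m        ≤⟨ m≤n ⟩
    fromℕ n        ≈⟨ +-identityʳ (fromℕ n) ⟨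
    fromℕ n + 0#   ∎))

-- Square roots, their increments, cube roots and logarithms.

module Roots (ℝ : RealNumbers) where

  open RealArithmetic ℝ
  open OrderedField ℝ
  open PartialOrderReasoning poset
  open Solver commutativeSemiring

  x²≈x*x : ∀ x → x ^ 2 ≈ x * x
  x²≈x*x x = *-congˡ (*-identityʳ x)

  x³≈x*x*x : ∀ x → x ^ 3 ≈ x * x * x
  x³≈x*x*x x = trans (*-congˡ (x²≈x*x x)) (sym (*-assoc x x x))

  0≤root : ∀ k .{{_ : ℕ.NonZero k}} x → 0# ≤ root k x
  0≤root k x = proj₁ (proj₂ (root-sup k x)) 0# (inj₁ refl)

  y²≤x⇒y≤√x : ∀ {x y} → 0# ≤ y → y * y ≤ x → y ≤ root 2 x
  y²≤x⇒y≤√x {x} {y} 0≤y y²≤x = proj₁ (proj₂ (root-sup 2 x)) y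
    (inj₂ (0≤y , ≤-trans (≤-reflexive (x²≈x*x y)) y²≤x))

  x≤y²⇒√x≤y : ∀ {x y} → 0# ≤ y → x ≤ y * y → root 2 x ≤ y
  x≤y²⇒√x≤y {x} {y} 0≤y x≤y² = proj₂ (proj₂ (root-sup 2 x)) y λ
    { z (inj₁ z≈0)         → ≤-trans (≤-reflexive z≈0) 0≤y
    ; z (inj₂ (0≤z , z²≤x)) → square-cancel-≤ 0≤y
        (≤-trans (≤-reflexive (sym (x²≈x*x z))) (≤-trans z²≤x x≤y²))
    }

  ½ : Carrier
  ½ = (1# + 1#) ⁻¹

  0<2 : 0# < 1# + 1#
  0<2 = <-≤-trans 0<1 (x≤x+y 1# 0≤1)

  ½*[x+x]≈x : ∀ x → ½ * (x + x) ≈ x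
  ½*[x+x]≈x x = trans (*-congˡ (solve 1 (λ x → x :+ x := (con 1 :+ con 1) :* x) refl x))
    (x⁻¹*[x*y]≈y x 0<2)

  -- The arithmetic mean of r and x / r is again an upper bound of the set
  -- defining r = √x, so r is at most x / r.
  √x*√x≤x : ∀ {x} → 0# ≤ x → root 2 x * root 2 x ≤ x
  √x*√x≤x {x} 0≤x with root 2 x ≈? 0#
  ... | yes r≈0 = ≤-trans (≤-reflexive (trans (*-congʳ r≈0) (zeroˡ _))) 0≤x
  ... | no  r≉0 = begin
    r * r ≤⟨ *-monoˡ-≤ 0≤r r≤t ⟩
    r * t ≈⟨ rt≈x ⟩
    x     ∎
    where
    r = root 2 x
    t = r ⁻¹ * x
    u = ½ * (r + t)

    0≤r : 0# ≤ r
    0≤r = 0≤root 2 x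

    0<r : 0# < r
    0<r = 0≤r , λ 0≈r → r≉0 (sym 0≈r)

    rt≈x : r * t ≈ x
    rt≈x = trans (sym (*-assoc r (r ⁻¹) x))
      (trans (*-congʳ (⁻¹-inverseʳ r r≉0)) (*-identityˡ x))

    0≤½ : 0# ≤ ½
    0≤½ = ⁻¹-nonneg 0<2

    0≤r+t : 0# ≤ r + t
    0≤r+t = ≤-trans 0≤r (x≤x+y r (*-nonneg (⁻¹-nonneg 0<r) 0≤x))

    x≤u² : x ≤ u * u
    x≤u² = begin
      x                               ≈⟨ ½*[x+x]≈x x ⟨
      ½ * (x + x)                     ≈⟨ ½*[x+x]≈x (½ * (x + x)) ⟨
      ½ * (½ * (x + x) + ½ * (x + x)) ≈⟨ *-congˡ (distribˡ ½ (x + x) (x + x)) ⟨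
      ½ * (½ * ((x + x) + (x + x)))   ≈⟨ *-congˡ (*-congˡ (+-cong (+-cong rt≈x rt≈x) (+-cong rt≈x rt≈x))) ⟨
      ½ * (½ * ((r * t + r * t) + (r * t + r * t)))
        ≤⟨ *-monoˡ-≤ 0≤½ (*-monoˡ-≤ 0≤½ (4xy≤[x+y]² r t)) ⟩
      ½ * (½ * ((r + t) * (r + t)))   ≈⟨ solve 2 (λ h s → h :* (h :* (s :* s)) := (h :* s) :* (h :* s)) refl ½ (r + t) ⟩
      u * u                           ∎

    r≤t : r ≤ t
    r≤t = +-cancelˡ-≤ r (begin
      r + r ≤⟨ +-mono-≤ r≤u r≤u ⟩
      u + u ≈⟨ distribˡ ½ (r + t) (r + t) ⟨
      ½ * ((r + t) + (r + t)) ≈⟨ ½*[x+x]≈x (r + t) ⟩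
      r + t ∎)
      where
      r≤u : r ≤ u
      r≤u = x≤y²⇒√x≤y (*-nonneg 0≤½ 0≤r+t) x≤u²

  -- The harmonic mean of r and x / r belongs to the set defining r = √x,
  -- so x / r is at most r.
  x≤√x*√x : ∀ {x} → 1# ≤ x → x ≤ root 2 x * root 2 x
  x≤√x*√x {x} 1≤x = +-cancelˡ-≤ x (*-cancelˡ-≤ 0<r (begin
    r * (x + x)   ≈⟨ distribˡ r x x ⟩
    r * x + r * x ≈⟨ Ny≈2rx ⟨
    N * y         ≤⟨ *-monoˡ-≤ (proj₁ 0<N) (y²≤x⇒y≤√x 0≤y y²≤x) ⟩
    N * r         ≈⟨ solve 2 (λ r x → (r :* r :+ x) :* r := r :* (x :+ r :* r)) refl r x ⟩
    r * (x + r * r) ∎))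
    where
    r = root 2 x
    N = r * r + x
    y = N ⁻¹ * (r * x + r * x)

    -- As 1 ≤ x, the number 1 lies in the set defining r; the positivity obtained this way allows r
    -- to be cancelled above.
    0<r : 0# < r
    0<r = <-≤-trans 0<1 (y²≤x⇒y≤√x 0≤1 (≤-trans (≤-reflexive (*-identityˡ 1#)) 1≤x))

    0≤x : 0# ≤ x
    0≤x = ≤-trans 0≤1 1≤x

    0<N : 0# < N
    0<N = <-≤-trans (<-≤-trans 0<1 1≤x)
      (≤-trans (x≤x+y x (0≤x*x r)) (≤-reflexive (+-comm x (r * r))))

    0≤rx : 0# ≤ r * x
    0≤rx = *-nonneg (proj₁ 0<r) 0≤x

    0≤y : 0# ≤ y
    0≤y = *-nonneg (⁻¹-nonneg 0<N) (≤-trans 0≤rx (x≤x+y (r * x) 0≤rx))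

    Ny≈2rx : N * y ≈ r * x + r * x
    Ny≈2rx = trans (sym (*-assoc N (N ⁻¹) _))
      (trans (*-congʳ (⁻¹-inverseʳ N (0<⇒≉0 0<N))) (*-identityˡ _))

    y²≤x : y * y ≤ x
    y²≤x = *-cancelˡ-≤ 0<N (*-cancelˡ-≤ 0<N (begin
      N * (N * (y * y))                   ≈⟨ solve 2 (λ N y → N :* (N :* (y :* y)) := (N :* y) :* (N :* y)) refl N y ⟩
      (N * y) * (N * y)                   ≈⟨ *-cong Ny≈2rx Ny≈2rx ⟩
      (r * x + r * x) * (r * x + r * x)   ≈⟨ solve 2 (λ r x → (r :* x :+ r :* x) :* (r :* x :+ r :* x) :=
        x :* ((r :* r :* x :+ r :* r :* x) :+ (r :* r :* x :+ r :* r :* x))) refl r x ⟩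
      x * ((r * r * x + r * r * x) + (r * r * x + r * r * x)) ≤⟨ *-monoˡ-≤ 0≤x (4xy≤[x+y]² (r * r) x) ⟩
      x * (N * N)                         ≈⟨ solve 2 (λ x N → x :* (N :* N) := N :* (N :* x)) refl x N ⟩
      N * (N * x)                         ∎))

  √ : ℕ → Carrier
  √ n = root 2 (fromℕ n)

  0≤√ : ∀ n → 0# ≤ √ n
  0≤√ n = 0≤root 2 (fromℕ n)

  √n*√n≈n : ∀ n → √ n * √ n ≈ fromℕ n
  √n*√n≈n zero      = ≤-antisym (√x*√x≤x ≤-refl) (0≤x*x _)
  √n*√n≈n n@(suc m) = ≤-antisym (√x*√x≤x (fromℕ-nonneg n))
    (x≤√x*√x (x≤x+y 1# (fromℕ-nonneg m)))

  √[n*n]≈n : ∀ n → √ (n ℕ.* n) ≈ fromℕ n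
  √[n*n]≈n n = square-injective (0≤√ (n ℕ.* n)) (fromℕ-nonneg n)
    (trans (√n*√n≈n (n ℕ.* n)) (fromℕ-homo-* n n))

  √-mono-< : ∀ n → √ n < √ (suc n)
  √-mono-< n = ≰⇒< λ h → <⇒≱ 0<1 (+-cancelˡ-≤ (fromℕ n) (begin
    fromℕ n + 1#              ≈⟨ +-comm (fromℕ n) 1# ⟩
    fromℕ (suc n)             ≈⟨ √n*√n≈n (suc n) ⟨
    √ (suc n) * √ (suc n)     ≤⟨ *-mono-≤ (0≤√ (suc n)) (0≤√ (suc n)) h h ⟩
    √ n * √ n                 ≈⟨ √n*√n≈n n ⟩
    fromℕ n                   ≈⟨ +-identityʳ (fromℕ n) ⟨
    fromℕ n + 0#              ∎))

  √Δ : ℕ → Carrier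
  √Δ n = √ (suc n) - √ n

  √+√Δ≈√ : ∀ n → √ n + √Δ n ≈ √ (suc n)
  √+√Δ≈√ n = x+[y-x]≈y (√ n) (√ (suc n))

  0≤√Δ : ∀ n → 0# ≤ √Δ n
  0≤√Δ n = x≤y⇒0≤y-x (proj₁ (√-mono-< n))

  0<√Δ : ∀ n → 0# < √Δ n
  0<√Δ n = 0≤√Δ n , λ 0≈Δ → proj₂ (√-mono-< n)
    (trans (sym (+-identityʳ (√ n))) (trans (+-congˡ 0≈Δ) (√+√Δ≈√ n)))

  +-cancelˡ-≈ : ∀ z {x y} → z + x ≈ z + y → x ≈ y
  +-cancelˡ-≈ z z+x≈z+y = ≤-antisym (+-cancelˡ-≤ z (≤-reflexive z+x≈z+y))
    (+-cancelˡ-≤ z (≤-reflexive (sym z+x≈z+y)))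

  -- This is (√n + √Δ n)² = n + 1 with n cancelled. The quadratic equation does the work of the
  -- closed form 1 / (√(n+1) + √n).
  2√√Δ+√Δ²≈1 : ∀ n → √ n * √Δ n + √ n * √Δ n + √Δ n * √Δ n ≈ 1#
  2√√Δ+√Δ²≈1 n = +-cancelˡ-≈ (a * a) (begin-equality
    a * a + (a * x + a * x + x * x) ≈⟨ solve 2 (λ a x →
      a :* a :+ (a :* x :+ a :* x :+ x :* x) := (a :+ x) :* (a :+ x)) refl a x ⟩
    (a + x) * (a + x)               ≈⟨ *-cong (√+√Δ≈√ n) (√+√Δ≈√ n) ⟩
    √ (suc n) * √ (suc n)           ≈⟨ √n*√n≈n (suc n) ⟩
    1# + fromℕ n                    ≈⟨ +-comm 1# (fromℕ n) ⟩
    fromℕ n + 1#                    ≈⟨ +-congʳ (√n*√n≈n n) ⟨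
    a * a + 1#                      ∎)
    where
    a = √ n
    x = √Δ n

  -- Were √Δ n ≤ √Δ (suc n), the equation 2√√Δ+√Δ²≈1 at suc n would exceed
  -- the one at n by at least 2 (√Δ n)².
  √Δ-anti-< : ∀ n → √Δ (suc n) < √Δ n
  √Δ-anti-< n = ≰⇒< λ x≤y → <⇒≱ (0<√Δ n) (square-cancel-≤ ≤-refl (begin
    x * x         ≤⟨ x≤x+y (x * x) (0≤x*x x) ⟩
    x * x + x * x ≤⟨ +-cancelˡ-≤ 1# (begin
      1# + (x * x + x * x)                             ≈⟨ +-congʳ (2√√Δ+√Δ²≈1 n) ⟨
      (a * x + a * x + x * x) + (x * x + x * x)        ≈⟨ solve 2 (λ a x →
        (a :* x :+ a :* x :+ x :* x) :+ (x :* x :+ x :* x) :=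
        (a :+ x) :* x :+ (a :+ x) :* x :+ x :* x) refl a x ⟩
      (a + x) * x + (a + x) * x + x * x                ≈⟨ +-congʳ (+-cong (*-congʳ (√+√Δ≈√ n)) (*-congʳ (√+√Δ≈√ n))) ⟩
      b * x + b * x + x * x                            ≤⟨ +-mono-≤ (+-mono-≤ (bx≤by x≤y) (bx≤by x≤y))
                                                            (*-mono-≤ (0≤√Δ n) (0≤√Δ n) x≤y x≤y) ⟩
      b * y + b * y + y * y                            ≈⟨ 2√√Δ+√Δ²≈1 (suc n) ⟩
      1#                                               ≈⟨ +-identityʳ 1# ⟨
      1# + 0#                                          ∎) ⟩
    0#            ≈⟨ zeroˡ 0# ⟨
    0# * 0#       ∎))
    where
    a = √ n
    b = √ (suc n)
    x = √Δ n
    y = √Δ (suc n)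
    bx≤by : x ≤ y → b * x ≤ b * y
    bx≤by = *-monoˡ-≤ (0≤√ (suc n))

  √Δ-anti-ℕ< : ∀ {m n} → m ℕ.< n → √Δ n < √Δ m
  √Δ-anti-ℕ< {m} {suc n} (s≤s m≤n) with ℕₚ.m≤n⇒m<n∨m≡n m≤n
  ... | inj₁ m<n     = <-≤-trans (√Δ-anti-< n) (proj₁ (√Δ-anti-ℕ< m<n))
  ... | inj₂ ≡.refl  = √Δ-anti-< n

  -- If ε³n ≤ 1, then ε³ ≤ 1/n would put ε into the set whose supremum is the cube root,
  -- contradicting that the root lies below ε. From here on the hypothesis on ε is free of roots.
  0<ε∧nε³>1 : ∀ {n ε} → 1 ℕ.≤ n → root 3 ((fromℕ n) ⁻¹) < ε →
              0# < ε × 1# < ε * ε * ε * fromℕ n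
  0<ε∧nε³>1 {n} {ε} 1≤n r<ε = 0<ε , ≰⇒< λ h → <⇒≱ r<ε
    (proj₁ (proj₂ (root-sup 3 ((fromℕ n) ⁻¹))) ε (inj₂ (proj₁ 0<ε ,
      ≤-trans (≤-reflexive (x³≈x*x*x ε)) (x*y≤1⇒x≤y⁻¹ (fromℕ-pos 1≤n) h))))
    where
    0<ε : 0# < ε
    0<ε = ≤-<-trans (0≤root 3 _) r<ε

  -- Every fraction p/q in the defining set satisfies 2^p ≤ n^q ≤ 2^(Lq), hence p ≤ qL.
  log₂≤ : ∀ {n} L → n ℕ.≤ 2 ℕ.^ L → log₂ n ≤ fromℕ L
  log₂≤ {n} L n≤2^L = proj₂ (proj₂ (log₂-sup n)) (fromℕ L) λ
    { y (inj₁ y≈0) → ≤-trans (≤-reflexive y≈0) (fromℕ-nonneg L)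
    ; y (inj₂ (p , q , 1≤q , yq≈p , 2^p≤n^q)) → *-cancelˡ-≤ (fromℕ-pos 1≤q) (begin
        fromℕ q * y       ≈⟨ *-comm (fromℕ q) y ⟩
        y * fromℕ q       ≈⟨ yq≈p ⟩
        fromℕ p           ≤⟨ fromℕ-mono-≤ {p} (p≤qL p q 2^p≤n^q) ⟩
        fromℕ (q ℕ.* L)   ≈⟨ fromℕ-homo-* q L ⟩
        fromℕ q * fromℕ L ∎)
    }
    where
    p≤qL : ∀ p q → 2 ℕ.^ p ℕ.≤ n ℕ.^ q → p ℕ.≤ q ℕ.* L
    p≤qL p q h = ℕₚ.≮⇒≥ λ qL<p → ℕₚ.<⇒≱
      (ℕₚ.^-monoʳ-< 2 (s≤s (s≤s z≤n)) (≡.subst (ℕ._< p) (ℕₚ.*-comm q L) qL<p))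
      (ℕₚ.≤-trans h (ℕₚ.≤-trans (ℕₚ.^-monoˡ-≤ q n≤2^L) (ℕₚ.≤-reflexive (ℕₚ.^-*-assoc 2 L q))))

-- Costs at the centre 0 as prefix sums of sorted distances.

module PrefixSums (ℝ : RealNumbers) where

  open Centrum ℝ
  open OrderedField ℝ
  open Roots ℝ
  open PartialOrderReasoning poset
  open Solver commutativeSemiring
  private
    module R = RingProperties ring
    ≥-decTotalOrder = Flip.decTotalOrder decTotalOrder
    ≥-totalOrder = Bundles.DecTotalOrder.totalOrder ≥-decTotalOrder

  open Sort ≥-decTotalOrder using (sort; sort-↭; sort-↗; sortingAlgorithm)

  -- Padding by 0 agrees with cost p, which sums all distances once p exceeds their number.
  nth : List Carrier → ℕ → Carrier
  nth []       _       = 0#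
  nth (x ∷ xs) zero    = x
  nth (x ∷ xs) (suc p) = nth xs p

  sum-take-suc : ∀ xs p → sum (take (suc p) xs) ≈ sum (take p xs) + nth xs p
  sum-take-suc []       zero    = sym (+-identityʳ 0#)
  sum-take-suc []       (suc p) = sym (+-identityʳ 0#)
  sum-take-suc (x ∷ xs) zero    = +-comm x 0#
  sum-take-suc (x ∷ xs) (suc p) = trans (+-congˡ (sum-take-suc xs p)) (sym (+-assoc x _ _))

  nth-anti : ∀ {xs} → Linked (λ x y → y ≤ x) xs → All (0# ≤_) xs → ∀ p → nth xs (suc p) ≤ nth xs p
  nth-anti []        _           p       = ≤-refl
  -- The entry after the last one is the padding 0, which stays below because the entries are
  -- nonnegative.
  nth-anti [-]       (0≤x ∷ _)   zero    = 0≤x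
  nth-anti [-]       _           (suc p) = ≤-refl
  nth-anti (y≤x ∷ _) _           zero    = y≤x
  nth-anti (_ ∷ xs↘) (_ ∷ 0≤xs)  (suc p) = nth-anti xs↘ 0≤xs p

  nth-nonneg : ∀ {xs} → All (0# ≤_) xs → ∀ p → 0# ≤ nth xs p
  nth-nonneg []           p       = ≤-refl
  nth-nonneg (0≤x ∷ _)    zero    = 0≤x
  nth-nonneg (_ ∷ 0≤xs)   (suc p) = nth-nonneg 0≤xs p

  -- Positivity tells a genuine entry from the padding.
  nth-∈ : ∀ xs p → 0# < nth xs p → nth xs p ∈ xs
  nth-∈ []       p       (_ , 0≉0) = contradiction refl 0≉0
  nth-∈ (x ∷ xs) zero    _         = here ≡.refl
  nth-∈ (x ∷ xs) (suc p) 0<        = there (nth-∈ xs p 0<)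

  sum-take-cong : ∀ {xs ys} → Pointwise _≈_ xs ys → ∀ p → sum (take p xs) ≈ sum (take p ys)
  sum-take-cong _            zero    = refl
  sum-take-cong []           (suc p) = refl
  sum-take-cong (x≈y ∷ rest) (suc p) = +-cong x≈y (sum-take-cong rest p)

  ∣x∣-nonneg : ∀ x → 0# ≤ ∣ x ∣
  ∣x∣-nonneg x with total 0# x
  ... | inj₁ 0≤x = ≤-trans 0≤x (x≤x⊔y x (- x))
  ... | inj₂ x≤0 = ≤-trans (x≤0⇒0≤-x x≤0) (x≤y⊔x x (- x))

  0≤x⇒∣x-0∣≈x : ∀ {x} → 0# ≤ x → ∣ x - 0# ∣ ≈ x
  0≤x⇒∣x-0∣≈x {x} 0≤x = trans (Max.x≤y⇒y⊔x≈y totalOrder (+-cancelˡ-≤ z (begin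
    z - z  ≈⟨ -‿inverseʳ z ⟩
    0#     ≤⟨ 0≤x ⟩
    x      ≈⟨ z≈x ⟨
    z      ≤⟨ x≤x+y z (≤-trans 0≤x (≤-reflexive (sym z≈x))) ⟩
    z + z  ∎))) z≈x
    where
    z = x - 0#
    z≈x : z ≈ x
    z≈x = trans (+-congˡ R.-0#≈0#) (+-identityʳ x)

  private
    dist : Carrier → Carrier
    dist y = ∣ y - 0# ∣

  -- The distances are already listed in descending order, and two sorted permutations of one list
  -- agree entrywise up to `≈`.
  cost-sorted : ∀ (f : ℕ → Carrier) n → (∀ i → dist (f (suc i)) ≤ dist (f i)) →
                ∀ p → cost p (applyUpTo f n) 0# ≈ sum (take p (applyUpTo (λ i → dist (f i)) n))
  cost-sorted f n anti p = trans
    (sum-take-cong (Sortedₚ.↗↭↗⇒≋ ≥-totalOrder (sort-↗ _) sorted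
      (SortBase.SortingAlgorithm.sort-↭ₛ sortingAlgorithm _)) p)
    (reflexive (≡.cong (λ xs → sum (take p xs)) (Listₚ.map-applyUpTo f dist n)))
    where
    sorted : Linked (λ x y → y ≤ x) (map dist (applyUpTo f n))
    sorted rewrite Listₚ.map-applyUpTo f dist n =
      Sortedₚ.applyUpTo⁺₂ ≥-totalOrder _ n anti

  dist-√Δ : ∀ i → dist (√Δ i) ≈ √Δ i
  dist-√Δ i = 0≤x⇒∣x-0∣≈x (0≤√Δ i)

  sum-applyUpTo-step : ∀ (f : ℕ → Carrier) n p → p ℕ.< n →
    sum (take (suc p) (applyUpTo f n)) ≈ sum (take p (applyUpTo f n)) + f p
  sum-applyUpTo-step f (suc n) zero    _         = +-comm (f 0) 0#
  sum-applyUpTo-step f (suc n) (suc p) (s≤s p<n) = trans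
    (+-congˡ (sum-applyUpTo-step (λ i → f (suc i)) n p p<n)) (sym (+-assoc (f 0) _ _))

  cost-√Δ : ∀ n p → p ℕ.≤ n → cost p (applyUpTo √Δ n) 0# ≈ √ p
  cost-√Δ n p p≤n = trans (cost-sorted √Δ n dist-anti p) (telescope p p≤n)
    where
    dist-anti : ∀ i → dist (√Δ (suc i)) ≤ dist (√Δ i)
    dist-anti i = begin
      dist (√Δ (suc i)) ≈⟨ dist-√Δ (suc i) ⟩
      √Δ (suc i)        ≤⟨ proj₁ (√Δ-anti-< i) ⟩
      √Δ i              ≈⟨ dist-√Δ i ⟨
      dist (√Δ i)       ∎

    telescope : ∀ p → p ℕ.≤ n → sum (take p (applyUpTo (λ i → dist (√Δ i)) n)) ≈ √ p
    telescope zero    _   = sym (√[n*n]≈n 0)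
    telescope (suc p) p<n = begin-equality
      sum (take (suc p) xs)            ≈⟨ sum-applyUpTo-step (λ i → dist (√Δ i)) n p p<n ⟩
      sum (take p xs) + dist (√Δ p)    ≈⟨ +-cong (telescope p (ℕₚ.<⇒≤ p<n)) (dist-√Δ p) ⟩
      √ p + √Δ p                       ≈⟨ √+√Δ≈√ p ⟩
      √ (suc p)                        ∎
      where
      xs = applyUpTo (λ i → dist (√Δ i)) n

  unique-√Δ : ∀ n → Unique (applyUpTo √Δ n)
  unique-√Δ n = Uniqueₚ.applyUpTo⁺₁ setoid √Δ n
    λ i<j _ √Δi≈√Δj → <⇒≱ (√Δ-anti-ℕ< i<j) (≤-reflexive √Δi≈√Δj)

  module _ (Y : List Carrier) where

    distances : List Carrier
    distances = sort (map dist Y)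

    -- Indexed from 0: `distance p` is the (p+1)-st largest distance, that is, the slope of the cost
    -- between p and p + 1.
    distance : ℕ → Carrier
    distance = nth distances

    0≤distances : All (0# ≤_) distances
    0≤distances = Permₚ.All-resp-↭ (Perm.↭-sym (sort-↭ (map dist Y)))
      (Allₚ.map⁺ (All.universal (λ y → ∣x∣-nonneg (y - 0#)) Y))

    distance-nonneg : ∀ p → 0# ≤ distance p
    distance-nonneg = nth-nonneg 0≤distances

    distance-anti : ∀ p → distance (suc p) ≤ distance p
    distance-anti = nth-anti (sort-↗ (map dist Y)) 0≤distances

    distance-attained : ∀ p → 0# < distance p → ∃[ y ] y ∈ Y × distance p ≡ dist y
    distance-attained p 0< = ∈ₚ.∈-map⁻ dist (Permₚ.∈-resp-↭ (sort-↭ (map dist Y)) (nth-∈ distances p 0<))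

    cost-suc : ∀ p → cost (suc p) Y 0# ≈ cost p Y 0# + distance p
    cost-suc = sum-take-suc distances

  module _ (s G : ℕ → Carrier) (s-anti : ∀ p → s (suc p) ≤ s p)
           (G-suc : ∀ p → G (suc p) ≈ G p + s p) where

    anti-+ : ∀ b j → s (b ℕ.+ j) ≤ s b
    anti-+ b zero    = ≤-reflexive (reflexive (≡.cong s (ℕₚ.+-identityʳ b)))
    anti-+ b (suc j) rewrite ℕₚ.+-suc b j = ≤-trans (s-anti (b ℕ.+ j)) (anti-+ b j)

    prefix-upper : ∀ b j → G (b ℕ.+ j) ≤ G b + fromℕ j * s b
    prefix-upper b zero rewrite ℕₚ.+-identityʳ b = x≤x+y (G b) (≤-reflexive (sym (zeroˡ (s b))))
    prefix-upper b (suc j) rewrite ℕₚ.+-suc b j = begin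
      G (suc (b ℕ.+ j))           ≈⟨ G-suc (b ℕ.+ j) ⟩
      G (b ℕ.+ j) + s (b ℕ.+ j)   ≤⟨ +-mono-≤ (prefix-upper b j) (anti-+ b j) ⟩
      G b + fromℕ j * s b + s b   ≈⟨ solve 3 (λ g j s → g :+ j :* s :+ s := g :+ (con 1 :+ j) :* s)
                                       refl (G b) (fromℕ j) (s b) ⟩
      G b + fromℕ (suc j) * s b   ∎

    -- All j slopes after b are at least `s (b + j)`. The bound `v` is a separate parameter so that
    -- it stays fixed in the induction and can later be taken to be `s b`.
    prefix-lower : ∀ b j v → v ≤ s (b ℕ.+ j) → G b + fromℕ j * v ≤ G (b ℕ.+ j)
    prefix-lower b zero v _ rewrite ℕₚ.+-identityʳ b =
      ≤-reflexive (trans (+-congˡ (zeroˡ v)) (+-identityʳ (G b)))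
    prefix-lower b (suc j) v v≤ rewrite ℕₚ.+-suc b j = begin
      G b + fromℕ (suc j) * v     ≈⟨ solve 3 (λ g j v → g :+ (con 1 :+ j) :* v := g :+ j :* v :+ v)
                                       refl (G b) (fromℕ j) v ⟩
      G b + fromℕ j * v + v       ≤⟨ +-mono-≤ (prefix-lower b j v v≤′) v≤′ ⟩
      G (b ℕ.+ j) + s (b ℕ.+ j)   ≈⟨ G-suc (b ℕ.+ j) ⟨
      G (suc (b ℕ.+ j))           ∎
      where
      v≤′ : v ≤ s (b ℕ.+ j)
      v≤′ = ≤-trans v≤ (s-anti (b ℕ.+ j))

    -- For antitone slopes the hypothesis forces them to be constant, so `G` is affine on the
    -- interval. Adding `X * G b` to both sides lets the upper bound on the first x steps meet the
    -- lower bound on all x + y steps without subtraction.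
    prefix-below-chord : ∀ b x y → s b ≤ s (b ℕ.+ (x ℕ.+ y)) →
      fromℕ (x ℕ.+ y) * G (b ℕ.+ x) ≤ fromℕ y * G b + fromℕ x * G (b ℕ.+ (x ℕ.+ y))
    prefix-below-chord b x y flat = +-cancelˡ-≤ (X * G b) (begin
      X * G b + Z * G (b ℕ.+ x)              ≤⟨ +-monoʳ-≤ (X * G b) (*-monoˡ-≤ (fromℕ-nonneg (x ℕ.+ y)) (prefix-upper b x)) ⟩
      X * G b + Z * (G b + X * s b)          ≈⟨ solve 4 (λ X Z g v → X :* g :+ Z :* (g :+ X :* v) := Z :* g :+ X :* (g :+ Z :* v)) refl X Z (G b) (s b) ⟩
      Z * G b + X * (G b + Z * s b)          ≤⟨ +-monoʳ-≤ (Z * G b) (*-monoˡ-≤ (fromℕ-nonneg x) (prefix-lower b (x ℕ.+ y) (s b) flat)) ⟩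
      Z * G b + X * G e                      ≈⟨ +-congʳ (*-congʳ (fromℕ-homo-+ x y)) ⟩
      (X + Y) * G b + X * G e                ≈⟨ solve 4 (λ X Y g h → (X :+ Y) :* g :+ X :* h := X :* g :+ (Y :* g :+ X :* h)) refl X Y (G b) (G e) ⟩
      X * G b + (Y * G b + X * G e)          ∎)
      where
      X = fromℕ x
      Y = fromℕ y
      Z = fromℕ (x ℕ.+ y)
      e = b ℕ.+ (x ℕ.+ y)

-- Leads from the multiset back to the distinct points, so that weights do not enter the count.
∈-concatMap-replicate⁻ : ∀ {A : Set} {y : A} (ps : List (A × ℕ)) →
  y ∈ concatMap (λ (x , w) → replicate w x) ps → y ∈ map proj₁ ps
∈-concatMap-replicate⁻ ((x , w) ∷ ps) y∈ with ∈ₚ.∈-++⁻ (replicate w x) y∈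
... | inj₁ y∈x  = here (All.lookup {P = _≡ x} (Allₚ.replicate⁺ w ≡.refl) y∈x)
... | inj₂ y∈ps = there (∈-concatMap-replicate⁻ ps y∈ps)

-- Counting points by rank.

module Ranks (ℝ : RealNumbers) where

  open Centrum ℝ
  open OrderedField ℝ

  module _ (f : Carrier → Carrier) where

    -- A potential that falls by at least one with every strict drop to a lower value from one
    -- attained by `f`. Successive drops thus bound the number of points without selecting a point
    -- for each.
    rank : List Carrier → Carrier → ℕ
    rank ys v = length (filter (λ y → f y ≤? v) ys)

    rank-≤-length : ∀ ys v → rank ys v ℕ.≤ length ys
    rank-≤-length ys v = Listₚ.length-filter (λ y → f y ≤? v) ys

    rank-mono-≤ : ∀ ys {v w} → v ≤ w → rank ys v ℕ.≤ rank ys w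
    rank-mono-≤ []       v≤w = z≤n
    rank-mono-≤ (y ∷ ys) {v} {w} v≤w with f y ≤? v | f y ≤? w
    ... | yes _  | yes _  = s≤s (rank-mono-≤ ys v≤w)
    ... | yes fy≤v | no  fy≰w = contradiction (≤-trans fy≤v v≤w) fy≰w
    ... | no  _  | yes _  = ℕₚ.m≤n⇒m≤1+n (rank-mono-≤ ys v≤w)
    ... | no  _  | no  _  = rank-mono-≤ ys v≤w

    rank-mono-< : ∀ {ys y v} → y ∈ ys → v < f y → rank ys v ℕ.< rank ys (f y)
    rank-mono-< {y ∷ ys} {v = v} (here ≡.refl) v<fy with f y ≤? v | f y ≤? f y
    ... | yes fy≤v | _        = contradiction fy≤v (<⇒≱ v<fy)
    ... | no  _    | yes _    = s≤s (rank-mono-≤ ys (proj₁ v<fy))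
    ... | no  _    | no fy≰fy = contradiction ≤-refl fy≰fy
    rank-mono-< {z ∷ ys} {y} {v} (there y∈ys) v<fy with f z ≤? v | f z ≤? f y
    ... | yes _    | yes _    = s≤s (rank-mono-< y∈ys v<fy)
    ... | yes fz≤v | no fz≰fy = contradiction (≤-trans fz≤v (proj₁ v<fy)) fz≰fy
    ... | no  _    | yes _    = ℕₚ.m≤n⇒m≤1+n (rank-mono-< y∈ys v<fy)
    ... | no  _    | no  _    = rank-mono-< y∈ys v<fy

-- One window forces one drop.

module Windows (ℝ : RealNumbers) where

  open Centrum ℝ
  open OrderedField ℝ
  open Roots ℝ
  open PrefixSums ℝ
  open Ranks ℝ
  open PartialOrderReasoning poset
  open Solver commutativeSemiring

  [1-ε]z+εz≈z : ∀ ε z → (1# - ε) * z + ε * z ≈ z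
  [1-ε]z+εz≈z ε z = trans (sym (distribʳ z (1# - ε) ε))
    (trans (*-congʳ (trans (+-comm (1# - ε) ε) (x+[y-x]≈y ε 1#))) (*-identityˡ z))

  ε<½⇒ε+ε<1 : ∀ {ε} → ε < (fromℕ 2) ⁻¹ → ε + ε < 1#
  ε<½⇒ε+ε<1 {ε} ε<½ = ≰⇒< λ 1≤ε+ε → <⇒≱ ε<½ (1≤x*y⇒y⁻¹≤x (fromℕ-pos {2} (s≤s z≤n)) (begin
    1#          ≤⟨ 1≤ε+ε ⟩
    ε + ε       ≈⟨ solve 1 (λ ε → ε :+ ε := ε :* (con 1 :+ (con 1 :+ con 0))) refl ε ⟩
    ε * fromℕ 2 ∎))

  module AtCoreset {ε : Carrier} (0<ε : 0# < ε) (2ε<1 : ε + ε < 1#) {n : ℕ} (D : WeightedSet)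
           (D-coreset : IsSimultaneousCoreset ε (applyUpTo √Δ n) D) where

    s G : ℕ → Carrier
    s = distance (multiset D)
    G p = cost p (multiset D) 0#

    coreset : ∀ k → 1 ℕ.≤ k → k ℕ.* k ℕ.≤ n →
      (1# - ε) * fromℕ k ≤ G (k ℕ.* k) × G (k ℕ.* k) ≤ (1# + ε) * fromℕ k
    coreset k 1≤k k²≤n with D-coreset (k ℕ.* k) (ℕₚ.*-mono-≤ 1≤k 1≤k)
      (≡.subst (k ℕ.* k ℕ.≤_) (≡.sym (Listₚ.length-applyUpTo √Δ n)) k²≤n) 0#
    ... | lower , upper =
      ≤-trans (≤-reflexive (*-congˡ (sym F≈k))) lower ,
      ≤-trans upper (≤-reflexive (*-congˡ F≈k))
      where
      F≈k : cost (k ℕ.* k) (applyUpTo √Δ n) 0# ≈ fromℕ k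
      F≈k = trans (cost-√Δ n (k ℕ.* k) k²≤n) (√[n*n]≈n k)

    -- On the squares of k < l = k + i < q = l + j the function √ takes the values k, l, q,
    -- and at l² the chord from k² to q² has height M / (q + k) with M = qk + l²,
    -- falling short of l by ij / (q + k).
    window-drop : ∀ x → ε * fromℕ x ≤ 1# → ∀ k i j → 1 ℕ.≤ k → 1 ℕ.≤ i → 1 ℕ.≤ j →
      let l = k ℕ.+ i ; q = l ℕ.+ j in q ℕ.* q ℕ.≤ n →
      4 ℕ.* (q ℕ.* k ℕ.+ l ℕ.* l) ℕ.≤ x ℕ.* (i ℕ.* j) →
      s (q ℕ.* q) < s (k ℕ.* k)
    window-drop x εx≤1 k i j 1≤k 1≤i 1≤j q²≤n wide = ≰⇒< λ flat →
      <⇒≱ 2ε<1 (*-cancelˡ-≤ (fromℕ-pos 1≤ij) (begin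
        I * 1#                   ≈⟨ *-identityʳ I ⟩
        I                        ≤⟨ +-cancelˡ-≤ I (begin
          -- Flatness gives I ≤ 2εM + εI. Taken twice, this is 2I ≤ 4εM + 2εI ≤ I + 2εI, which is
          -- impossible for 2ε < 1; hence the factor 4 in the width hypothesis.
          I + I                                             ≤⟨ +-mono-≤ (I≤ flat) (I≤ flat) ⟩
          (ε * M + ε * (M + I)) + (ε * M + ε * (M + I))     ≈⟨ solve 3 (λ ε M I →
            (ε :* M :+ ε :* (M :+ I)) :+ (ε :* M :+ ε :* (M :+ I)) :=
            ε :* ((con 1 :+ (con 1 :+ (con 1 :+ (con 1 :+ con 0)))) :* M) :+ I :* (ε :+ ε)) refl ε M I ⟩
          ε * (fromℕ 4 * M) + I * (ε + ε)                   ≤⟨ +-monoˡ-≤ _ 4εM≤I ⟩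
          I + I * (ε + ε)                                   ∎) ⟩
        I * (ε + ε)              ∎))
      where
      l = k ℕ.+ i
      q = l ℕ.+ j
      m = q ℕ.* k ℕ.+ l ℕ.* l
      M = fromℕ m
      I = fromℕ (i ℕ.* j)
      Δ₁ = i ℕ.* (k ℕ.+ l)
      Δ₂ = j ℕ.* (l ℕ.+ q)

      1≤l : 1 ℕ.≤ l
      1≤l = ℕₚ.≤-trans 1≤k (ℕₚ.m≤m+n k i)

      l≤q : l ℕ.≤ q
      l≤q = ℕₚ.m≤m+n l j

      k≤q : k ℕ.≤ q
      k≤q = ℕₚ.≤-trans (ℕₚ.m≤m+n k i) l≤q

      1≤ij : 1 ℕ.≤ i ℕ.* j
      1≤ij = ℕₚ.*-mono-≤ 1≤i 1≤j

      4εM≤I : ε * (fromℕ 4 * M) ≤ I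
      4εM≤I = begin
        ε * (fromℕ 4 * M)             ≈⟨ *-congˡ (fromℕ-homo-* 4 m) ⟨
        ε * fromℕ (4 ℕ.* m)           ≤⟨ *-monoˡ-≤ (proj₁ 0<ε) (fromℕ-mono-≤ wide) ⟩
        ε * fromℕ (x ℕ.* (i ℕ.* j))   ≈⟨ *-congˡ (fromℕ-homo-* x (i ℕ.* j)) ⟩
        ε * (fromℕ x * I)             ≈⟨ *-assoc ε (fromℕ x) I ⟨
        ε * fromℕ x * I               ≤⟨ *-monoʳ-≤ (fromℕ-nonneg (i ℕ.* j)) εx≤1 ⟩
        1# * I                        ≈⟨ *-identityˡ I ⟩
        I                             ∎

      l²≡ : k ℕ.* k ℕ.+ Δ₁ ≡ l ℕ.* l
      l²≡ = ℕsolve 2 (λ k i → k :*ℕ k :+ℕ i :*ℕ (k :+ℕ (k :+ℕ i)) :=ℕ (k :+ℕ i) :*ℕ (k :+ℕ i)) ≡.refl k i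

      q²≡ : k ℕ.* k ℕ.+ (Δ₁ ℕ.+ Δ₂) ≡ q ℕ.* q
      q²≡ = ≡.trans (≡.sym (ℕₚ.+-assoc (k ℕ.* k) Δ₁ Δ₂)) (≡.trans (≡.cong (ℕ._+ Δ₂) l²≡)
        (ℕsolve 2 (λ l j → l :*ℕ l :+ℕ j :*ℕ (l :+ℕ (l :+ℕ j)) :=ℕ (l :+ℕ j) :*ℕ (l :+ℕ j)) ≡.refl l j))

      -- Since Δ₁ + Δ₂ = q² - k² = (i + j)(q + k), cancelling i + j leaves (q + k)l = m + ij. The
      -- companion identity gives m itself for the chord, with the same factor i + j.
      chord-left : (Δ₁ ℕ.+ Δ₂) ℕ.* l ≡ (i ℕ.+ j) ℕ.* (m ℕ.+ i ℕ.* j)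
      chord-left = ℕsolve 3 (λ k i j → let l = k :+ℕ i ; q = l :+ℕ j in
        (i :*ℕ (k :+ℕ l) :+ℕ j :*ℕ (l :+ℕ q)) :*ℕ l :=ℕ
        (i :+ℕ j) :*ℕ ((q :*ℕ k :+ℕ l :*ℕ l) :+ℕ i :*ℕ j)) ≡.refl k i j

      chord-right : Δ₂ ℕ.* k ℕ.+ Δ₁ ℕ.* q ≡ (i ℕ.+ j) ℕ.* m
      chord-right = ℕsolve 3 (λ k i j → let l = k :+ℕ i ; q = l :+ℕ j in
        j :*ℕ (l :+ℕ q) :*ℕ k :+ℕ i :*ℕ (k :+ℕ l) :*ℕ q :=ℕ
        (i :+ℕ j) :*ℕ (q :*ℕ k :+ℕ l :*ℕ l)) ≡.refl k i j

      module _ (flat : s (k ℕ.* k) ≤ s (q ℕ.* q)) where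

        chord : fromℕ (Δ₁ ℕ.+ Δ₂) * G (l ℕ.* l) ≤ fromℕ Δ₂ * G (k ℕ.* k) + fromℕ Δ₁ * G (q ℕ.* q)
        chord = ≡.subst₂ (λ a e → fromℕ (Δ₁ ℕ.+ Δ₂) * G a ≤ fromℕ Δ₂ * G (k ℕ.* k) + fromℕ Δ₁ * G e)
          l²≡ q²≡
          (prefix-below-chord s G (distance-anti (multiset D)) (cost-suc (multiset D)) (k ℕ.* k) Δ₁ Δ₂
            (≡.subst (λ e → s (k ℕ.* k) ≤ s e) (≡.sym q²≡) flat))

        -- The lower coreset bound is applied at the middle node and the upper one at both ends,
        -- which turns the chord inequality into one between M + I and M.
        [1-ε][M+I]≤[1+ε]M : (1# - ε) * (M + I) ≤ (1# + ε) * M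
        [1-ε][M+I]≤[1+ε]M = *-cancelˡ-≤ (fromℕ-pos {i ℕ.+ j} (ℕₚ.≤-trans 1≤i (ℕₚ.m≤m+n i j))) (begin
          W * (g * (M + I))                        ≈⟨ solve 3 (λ W g z → W :* (g :* z) := g :* (W :* z)) refl W g (M + I) ⟩
          g * (W * (M + I))                        ≈⟨ *-congˡ (*-congˡ (fromℕ-homo-+ m (i ℕ.* j))) ⟨
          g * (W * fromℕ (m ℕ.+ i ℕ.* j))          ≈⟨ *-congˡ (fromℕ-homo-* (i ℕ.+ j) (m ℕ.+ i ℕ.* j)) ⟨
          g * fromℕ ((i ℕ.+ j) ℕ.* (m ℕ.+ i ℕ.* j)) ≈⟨ *-congˡ (fromℕ-cong chord-left) ⟨
          g * fromℕ ((Δ₁ ℕ.+ Δ₂) ℕ.* l)            ≈⟨ *-congˡ (fromℕ-homo-* (Δ₁ ℕ.+ Δ₂) l) ⟩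
          g * (fromℕ (Δ₁ ℕ.+ Δ₂) * fromℕ l)        ≈⟨ solve 3 (λ g z l → g :* (z :* l) := z :* (g :* l)) refl g _ _ ⟩
          fromℕ (Δ₁ ℕ.+ Δ₂) * (g * fromℕ l)        ≤⟨ *-monoˡ-≤ (fromℕ-nonneg (Δ₁ ℕ.+ Δ₂)) (proj₁ (coreset l 1≤l (ℕₚ.≤-trans (ℕₚ.*-mono-≤ l≤q l≤q) q²≤n))) ⟩
          fromℕ (Δ₁ ℕ.+ Δ₂) * G (l ℕ.* l)          ≤⟨ chord ⟩
          fromℕ Δ₂ * G (k ℕ.* k) + fromℕ Δ₁ * G (q ℕ.* q) ≤⟨ +-mono-≤
            (*-monoˡ-≤ (fromℕ-nonneg Δ₂) (proj₂ (coreset k 1≤k (ℕₚ.≤-trans (ℕₚ.*-mono-≤ k≤q k≤q) q²≤n))))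
            (*-monoˡ-≤ (fromℕ-nonneg Δ₁) (proj₂ (coreset q (ℕₚ.≤-trans 1≤l l≤q) q²≤n))) ⟩
          fromℕ Δ₂ * (f * fromℕ k) + fromℕ Δ₁ * (f * fromℕ q) ≈⟨ solve 5 (λ y x f k q →
            y :* (f :* k) :+ x :* (f :* q) := f :* (y :* k :+ x :* q)) refl (fromℕ Δ₂) (fromℕ Δ₁) f (fromℕ k) (fromℕ q) ⟩
          f * (fromℕ Δ₂ * fromℕ k + fromℕ Δ₁ * fromℕ q) ≈⟨ *-congˡ (+-cong (fromℕ-homo-* Δ₂ k) (fromℕ-homo-* Δ₁ q)) ⟨
          f * (fromℕ (Δ₂ ℕ.* k) + fromℕ (Δ₁ ℕ.* q)) ≈⟨ *-congˡ (fromℕ-homo-+ (Δ₂ ℕ.* k) (Δ₁ ℕ.* q)) ⟨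
          f * fromℕ (Δ₂ ℕ.* k ℕ.+ Δ₁ ℕ.* q)        ≈⟨ *-congˡ (fromℕ-cong chord-right) ⟩
          f * fromℕ ((i ℕ.+ j) ℕ.* m)              ≈⟨ *-congˡ (fromℕ-homo-* (i ℕ.+ j) m) ⟩
          f * (W * M)                              ≈⟨ solve 3 (λ f W M → f :* (W :* M) := W :* (f :* M)) refl f W M ⟩
          W * (f * M)                              ∎)
          where
          g = 1# - ε
          f = 1# + ε
          W = fromℕ (i ℕ.+ j)

        I≤ : I ≤ ε * M + ε * (M + I)
        I≤ = +-cancelˡ-≤ M (begin
          M + I                                ≈⟨ [1-ε]z+εz≈z ε (M + I) ⟨
          (1# - ε) * (M + I) + ε * (M + I)     ≤⟨ +-monoˡ-≤ _ [1-ε][M+I]≤[1+ε]M ⟩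
          (1# + ε) * M + ε * (M + I)           ≈⟨ solve 3 (λ ε M z → (con 1 :+ ε) :* M :+ z := M :+ (ε :* M :+ z)) refl ε M _ ⟩
          M + (ε * M + ε * (M + I))            ∎)

    locations : List Carrier
    locations = map proj₁ (WeightedSet.points D)

    rankAt : ℕ → ℕ
    rankAt k = rank (λ y → ∣ y - 0# ∣) locations (s (k ℕ.* k))

    rankAt-≤-size : ∀ k → rankAt k ℕ.≤ size D
    rankAt-≤-size k = ℕₚ.≤-trans (rank-≤-length _ locations _)
      (ℕₚ.≤-reflexive (Listₚ.length-map proj₁ (WeightedSet.points D)))

    -- The smaller distance is nonnegative, so the larger one is positive and belongs to a point of
    -- `D` instead of the padding. That point is counted at k but not at q.
    rankAt-drop : ∀ {k q} → s (q ℕ.* q) < s (k ℕ.* k) → suc (rankAt q) ℕ.≤ rankAt k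
    rankAt-drop {k} {q} drop
      with y , y∈D , s≡ ← distance-attained (multiset D) (k ℕ.* k)
             (≤-<-trans (distance-nonneg (multiset D) (q ℕ.* q)) drop)
      rewrite s≡ = rank-mono-< _ (∈-concatMap-replicate⁻ (WeightedSet.points D) y∈D) drop

    -- The endpoint `q` is tied to k + i + j by an equation, so that nodes given by other formulas
    -- fit directly.
    rankAt-window : ∀ x → ε * fromℕ x ≤ 1# → ∀ k i j q → 1 ℕ.≤ k → 1 ℕ.≤ i → 1 ℕ.≤ j →
      k ℕ.+ i ℕ.+ j ≡ q → q ℕ.* q ℕ.≤ n →
      4 ℕ.* (q ℕ.* k ℕ.+ (k ℕ.+ i) ℕ.* (k ℕ.+ i)) ℕ.≤ x ℕ.* (i ℕ.* j) →
      suc (rankAt q) ℕ.≤ rankAt k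
    rankAt-window x εx≤1 k i j q 1≤k 1≤i 1≤j ≡.refl q²≤n wide =
      rankAt-drop {k} {q} (window-drop x εx≤1 k i j 1≤k 1≤i 1≤j q²≤n wide)

-- Chains of windows across all scales.

module Chains (ℝ : RealNumbers) where

  open Centrum ℝ
  open Roots ℝ using (√Δ)
  open Windows ℝ
  open ℕₚ.≤-Reasoning

  module _ {ε : Carrier} (0<ε : 0# < ε) (2ε<1 : ε + ε < 1#) {n : ℕ} (D : WeightedSet)
           (D-coreset : IsSimultaneousCoreset ε (applyUpTo √Δ n) D) where

    open AtCoreset 0<ε 2ε<1 D D-coreset

    block-size-bound : ∀ B k₀ m → 1 ℕ.≤ B →
      (∀ d → 1 ℕ.≤ d → B ℕ.* (k₀ ℕ.* d) ℕ.* (B ℕ.* (k₀ ℕ.* d)) ℕ.≤ n →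
       m ℕ.+ rankAt (B ℕ.* (k₀ ℕ.* d)) ℕ.≤ rankAt (k₀ ℕ.* d)) →
      ∀ S → k₀ ℕ.* B ℕ.^ S ℕ.* (k₀ ℕ.* B ℕ.^ S) ℕ.≤ n → S ℕ.* m ℕ.≤ size D
    block-size-bound B k₀ m 1≤B block S q²≤n = begin
      S ℕ.* m                              ≤⟨ ℕₚ.m≤m+n (S ℕ.* m) _ ⟩
      S ℕ.* m ℕ.+ rankAt (k₀ ℕ.* B ℕ.^ S)  ≤⟨ Arithmetic.iterate-block rankAt n B k₀ m 1≤B block S q²≤n ⟩
      rankAt (k₀ ℕ.* 1)                    ≤⟨ rankAt-≤-size (k₀ ℕ.* 1) ⟩
      size D                               ∎

    -- The window has nodes d, 8d, 64d. For given ends, the geometric mean as middle node maximises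
    -- ij / (qk + l²). The ratio 8 is wide enough for every ε ≤ 1/2, and as a power of 2 it keeps
    -- the logarithms integral.
    coarse-size-bound : ε * fromℕ 2 ≤ 1# → ∀ S →
      1 ℕ.* 64 ℕ.^ S ℕ.* (1 ℕ.* 64 ℕ.^ S) ℕ.≤ n → S ℕ.* 1 ℕ.≤ size D
    coarse-size-bound 2ε≤1 = block-size-bound 64 1 1 (s≤s z≤n) λ d 1≤d q²≤n →
      rankAt-window 2 2ε≤1 (1 ℕ.* d) (7 ℕ.* d) (56 ℕ.* d) (64 ℕ.* (1 ℕ.* d))
        (scale 0 d 1≤d) (scale 6 d 1≤d) (scale 55 d 1≤d)
        (ℕsolve 1 (λ d → conℕ 1 :*ℕ d :+ℕ conℕ 7 :*ℕ d :+ℕ conℕ 56 :*ℕ d :=ℕ conℕ 64 :*ℕ (conℕ 1 :*ℕ d)) ≡.refl d)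
        q²≤n
        (begin
          4 ℕ.* (64 ℕ.* (1 ℕ.* d) ℕ.* (1 ℕ.* d) ℕ.+ (1 ℕ.* d ℕ.+ 7 ℕ.* d) ℕ.* (1 ℕ.* d ℕ.+ 7 ℕ.* d))
            ≡⟨ ℕsolve 1 (λ d → conℕ 4 :*ℕ (conℕ 64 :*ℕ (conℕ 1 :*ℕ d) :*ℕ (conℕ 1 :*ℕ d) :+ℕ
                 (conℕ 1 :*ℕ d :+ℕ conℕ 7 :*ℕ d) :*ℕ (conℕ 1 :*ℕ d :+ℕ conℕ 7 :*ℕ d)) :=ℕ
                 conℕ 512 :*ℕ (d :*ℕ d)) ≡.refl d ⟩
          512 ℕ.* (d ℕ.* d) ≤⟨ ℕₚ.*-monoˡ-≤ (d ℕ.* d) {512} {784} (ℕₚ.m≤m+n 512 272) ⟩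
          784 ℕ.* (d ℕ.* d) ≡⟨ ℕsolve 1 (λ d → conℕ 784 :*ℕ (d :*ℕ d) :=ℕ
                                 conℕ 2 :*ℕ ((conℕ 7 :*ℕ d) :*ℕ (conℕ 56 :*ℕ d))) ≡.refl d ⟩
          2 ℕ.* ((7 ℕ.* d) ℕ.* (56 ℕ.* d)) ∎)
      where
      scale : ∀ c d → 1 ℕ.≤ d → 1 ℕ.≤ suc c ℕ.* d
      scale c d 1≤d = ℕₚ.≤-trans 1≤d (ℕₚ.m≤m+n d (c ℕ.* d))

    -- A doubling block from 2wd to 4wd is cut at 2(w+t)d into w windows. The factor 2 makes each
    -- midpoint an integer, with i = j = d.
    fine-size-bound : ∀ w → 1 ℕ.≤ w → ε * fromℕ (128 ℕ.* (w ℕ.* w)) ≤ 1# → ∀ S →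
      2 ℕ.* w ℕ.* 2 ℕ.^ S ℕ.* (2 ℕ.* w ℕ.* 2 ℕ.^ S) ℕ.≤ n → S ℕ.* w ℕ.≤ size D
    fine-size-bound w 1≤w 128εw²≤1 = block-size-bound 2 (2 ℕ.* w) w (s≤s z≤n) block
      where
      module _ (d : ℕ) (1≤d : 1 ℕ.≤ d) (q²≤n : 2 ℕ.* (2 ℕ.* w ℕ.* d) ℕ.* (2 ℕ.* (2 ℕ.* w ℕ.* d)) ℕ.≤ n) where

        node : ℕ → ℕ
        node t = 2 ℕ.* (w ℕ.+ t) ℕ.* d

        top : ℕ
        top = 2 ℕ.* (2 ℕ.* w ℕ.* d)

        node-w≡top : node w ≡ top
        node-w≡top = ℕsolve 2 (λ w d → conℕ 2 :*ℕ (w :+ℕ w) :*ℕ d :=ℕ conℕ 2 :*ℕ (conℕ 2 :*ℕ w :*ℕ d)) ≡.refl w d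

        node≤top : ∀ t → t ℕ.≤ w → node t ℕ.≤ top
        node≤top t t≤w = begin
          2 ℕ.* (w ℕ.+ t) ℕ.* d ≤⟨ ℕₚ.*-monoˡ-≤ d (ℕₚ.*-monoʳ-≤ 2 (ℕₚ.+-monoʳ-≤ w t≤w)) ⟩
          2 ℕ.* (w ℕ.+ w) ℕ.* d ≡⟨ node-w≡top ⟩
          top                   ∎

        1≤node : ∀ t → 1 ℕ.≤ node t
        1≤node t = ℕₚ.*-mono-≤ {1} {2 ℕ.* (w ℕ.+ t)}
          (ℕₚ.≤-trans 1≤w (ℕₚ.≤-trans (ℕₚ.m≤m+n w t) (ℕₚ.m≤m+n (w ℕ.+ t) _))) 1≤d

        chain : ∀ t → t ℕ.≤ w → t ℕ.+ rankAt (node t) ℕ.≤ rankAt (node 0)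
        chain zero    _   = ℕₚ.≤-refl
        chain (suc t) t<w = begin
          suc t ℕ.+ rankAt q    ≡⟨ ℕₚ.+-suc t (rankAt q) ⟨
          t ℕ.+ suc (rankAt q)  ≤⟨ ℕₚ.+-monoʳ-≤ t (rankAt-window (128 ℕ.* (w ℕ.* w)) 128εw²≤1 k d d q
                                     (1≤node t) 1≤d 1≤d q≡ (ℕₚ.≤-trans (Arithmetic.square-mono-≤ q≤top) q²≤n) wide) ⟩
          t ℕ.+ rankAt k        ≤⟨ chain t (ℕₚ.<⇒≤ t<w) ⟩
          rankAt (node 0)       ∎
          where
          k = node t
          l = k ℕ.+ d
          q = node (suc t)
          q≡ : l ℕ.+ d ≡ q
          q≡ = ℕsolve 3 (λ w t d → conℕ 2 :*ℕ (w :+ℕ t) :*ℕ d :+ℕ d :+ℕ d :=ℕ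
            conℕ 2 :*ℕ (w :+ℕ (conℕ 1 :+ℕ t)) :*ℕ d) ≡.refl w t d
          q≤top : q ℕ.≤ top
          q≤top = node≤top (suc t) t<w
          l≤top : l ℕ.≤ top
          l≤top = ℕₚ.≤-trans (ℕₚ.m≤m+n l d) (ℕₚ.≤-trans (ℕₚ.≤-reflexive q≡) q≤top)
          k≤top : k ℕ.≤ top
          k≤top = node≤top t (ℕₚ.<⇒≤ t<w)
          wide : 4 ℕ.* (q ℕ.* k ℕ.+ l ℕ.* l) ℕ.≤ 128 ℕ.* (w ℕ.* w) ℕ.* (d ℕ.* d)
          -- Every node is at most 4wd, so 4(qk + l²) ≤ 8(4wd)² = 128w²d². This is the origin of
          -- 128.
          wide = begin
            4 ℕ.* (q ℕ.* k ℕ.+ l ℕ.* l)         ≤⟨ ℕₚ.*-monoʳ-≤ 4 (ℕₚ.+-mono-≤ (ℕₚ.*-mono-≤ q≤top k≤top) (Arithmetic.square-mono-≤ l≤top)) ⟩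
            4 ℕ.* (top ℕ.* top ℕ.+ top ℕ.* top) ≡⟨ ℕsolve 2 (λ w d → let top = conℕ 2 :*ℕ (conℕ 2 :*ℕ w :*ℕ d) in
              conℕ 4 :*ℕ (top :*ℕ top :+ℕ top :*ℕ top) :=ℕ conℕ 128 :*ℕ (w :*ℕ w) :*ℕ (d :*ℕ d)) ≡.refl w d ⟩
            128 ℕ.* (w ℕ.* w) ℕ.* (d ℕ.* d)     ∎

        block : w ℕ.+ rankAt top ℕ.≤ rankAt (2 ℕ.* w ℕ.* d)
        block = ≡.subst₂ (λ a b → w ℕ.+ rankAt a ℕ.≤ rankAt b) node-w≡top
          (≡.cong (λ w → 2 ℕ.* w ℕ.* d) (ℕₚ.+-identityʳ w))
          (chain w ℕₚ.≤-refl)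

-- Assembling the lower bound.

module LowerBound (ℝ : RealNumbers) where

  open Centrum ℝ
  open OrderedField ℝ
  open Roots ℝ
  open Windows ℝ using (ε<½⇒ε+ε<1)
  open Chains ℝ
  open PartialOrderReasoning poset
  open Solver commutativeSemiring
  open Arithmetic using (bounded-search; last-scale)

  c : Carrier
  c = (fromℕ 288) ⁻¹

  0<288 : 0# < fromℕ 288
  0<288 = fromℕ-pos {288} (s≤s z≤n)

  c*√ε⁻¹*log₂≤ : ∀ {ε n N} R L T → root 2 (ε ⁻¹) ≤ fromℕ R → log₂ n ≤ fromℕ L →
    R ℕ.* L ℕ.≤ 288 ℕ.* T → T ℕ.≤ N → c * root 2 (ε ⁻¹) * log₂ n ≤ fromℕ N
  c*√ε⁻¹*log₂≤ {ε} {n} {N} R L T √≤R log≤L RL≤288T T≤N = begin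
    c * root 2 (ε ⁻¹) * log₂ n   ≈⟨ *-assoc c _ _ ⟩
    c * (root 2 (ε ⁻¹) * log₂ n) ≤⟨ *-monoˡ-≤ (⁻¹-nonneg 0<288) (*-mono-≤ (0≤root 2 _) 0≤log √≤R log≤L) ⟩
    c * (fromℕ R * fromℕ L)      ≈⟨ *-congˡ (fromℕ-homo-* R L) ⟨
    c * fromℕ (R ℕ.* L)          ≤⟨ *-monoˡ-≤ (⁻¹-nonneg 0<288) (fromℕ-mono-≤ RL≤288T) ⟩
    c * fromℕ (288 ℕ.* T)        ≈⟨ *-congˡ (fromℕ-homo-* 288 T) ⟩
    c * (fromℕ 288 * fromℕ T)    ≈⟨ x⁻¹*[x*y]≈y (fromℕ T) 0<288 ⟩
    fromℕ T                      ≤⟨ fromℕ-mono-≤ T≤N ⟩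
    fromℕ N                      ∎
    where
    0≤log : 0# ≤ log₂ n
    0≤log = proj₁ (proj₂ (log₂-sup n)) 0# (inj₁ refl)

  √ε⁻¹≤ : ∀ {ε} x R → 0# < ε → 1# ≤ ε * fromℕ x → x ℕ.≤ R ℕ.* R → root 2 (ε ⁻¹) ≤ fromℕ R
  √ε⁻¹≤ {ε} x R 0<ε 1≤εx x≤R² = x≤y²⇒√x≤y (fromℕ-nonneg R) (begin
    ε ⁻¹              ≤⟨ 1≤x*y⇒y⁻¹≤x 0<ε (≤-trans 1≤εx (≤-reflexive (*-comm ε (fromℕ x)))) ⟩
    fromℕ x           ≤⟨ fromℕ-mono-≤ x≤R² ⟩
    fromℕ (R ℕ.* R)   ≈⟨ fromℕ-homo-* R R ⟩
    fromℕ R * fromℕ R ∎)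

  -- This is u ≤ 1/ε < n^(1/3), obtained from u³ ≤ u³(ε³n) = (εu)³n ≤ n.
  u³≤n : ∀ {ε} n u → 0# < ε → 1# < ε * ε * ε * fromℕ n → ε * fromℕ u ≤ 1# → u ℕ.* u ℕ.* u ℕ.≤ n
  u³≤n {ε} n u 0<ε 1<ε³n εu≤1 = fromℕ-cancel-≤ (begin
    fromℕ (u ℕ.* u ℕ.* u)             ≈⟨ trans (fromℕ-homo-* (u ℕ.* u) u) (*-congʳ (fromℕ-homo-* u u)) ⟩
    U³                                ≈⟨ *-identityʳ U³ ⟨
    U³ * 1#                           ≤⟨ *-monoˡ-≤ (*-nonneg (*-nonneg 0≤U 0≤U) 0≤U) (proj₁ 1<ε³n) ⟩
    U³ * (ε * ε * ε * fromℕ n)        ≈⟨ solve 3 (λ U ε n → U :* U :* U :* (ε :* ε :* ε :* n) :=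
                                           (ε :* U) :* (ε :* U) :* (ε :* U) :* n) refl U ε (fromℕ n) ⟩
    (ε * U) * (ε * U) * (ε * U) * fromℕ n ≤⟨ *-monoʳ-≤ (fromℕ-nonneg n) (*-mono-≤ (*-nonneg 0≤εU 0≤εU) 0≤εU (*-mono-≤ 0≤εU 0≤εU εu≤1 εu≤1) εu≤1) ⟩
    1# * 1# * 1# * fromℕ n            ≈⟨ solve 1 (λ n → con 1 :* con 1 :* con 1 :* n := n) refl (fromℕ n) ⟩
    fromℕ n                           ∎)
    where
    U = fromℕ u
    U³ = U * U * U
    0≤U : 0# ≤ U
    0≤U = fromℕ-nonneg u
    0≤εU : 0# ≤ ε * U
    0≤εU = *-nonneg (proj₁ 0<ε) 0≤U

  -- Shows that the search for w has failed by w = n.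
  1<128εn² : ∀ {ε n} → 0# < ε → ε ≤ 1# → 1 ℕ.≤ n → 1# < ε * ε * ε * fromℕ n →
    1# < ε * fromℕ (128 ℕ.* (n ℕ.* n))
  1<128εn² {ε} {n} 0<ε ε≤1 1≤n 1<ε³n = <-≤-trans 1<ε³n (begin
    ε * ε * ε * fromℕ n         ≤⟨ *-monoʳ-≤ (fromℕ-nonneg n) (*-monoʳ-≤ (proj₁ 0<ε) (*-mono-≤ (proj₁ 0<ε) (proj₁ 0<ε) ε≤1 ε≤1)) ⟩
    1# * 1# * ε * fromℕ n       ≈⟨ solve 2 (λ ε n → con 1 :* con 1 :* ε :* n := ε :* n) refl ε (fromℕ n) ⟩
    ε * fromℕ n                 ≤⟨ *-monoˡ-≤ (proj₁ 0<ε) (fromℕ-mono-≤ (ℕₚ.≤-trans n≤n² (ℕₚ.m≤m+n (n ℕ.* n) _))) ⟩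
    ε * fromℕ (128 ℕ.* (n ℕ.* n)) ∎)
    where
    n≤n² : n ℕ.≤ n ℕ.* n
    n≤n² = ℕₚ.m≤n*m n n {{ℕ.>-nonZero 1≤n}}

  module _ {n : ℕ} (4096≤n : 4096 ℕ.≤ n) {ε : Carrier} (0<ε : 0# < ε) (2ε<1 : ε + ε < 1#)
           (1<ε³n : 1# < ε * ε * ε * fromℕ n) (D : WeightedSet)
           (D-coreset : IsSimultaneousCoreset ε (applyUpTo √Δ n) D) where

    1≤n : 1 ℕ.≤ n
    1≤n = ℕₚ.≤-trans (s≤s z≤n) 4096≤n

    -- Here √(1/ε) ≤ 12, so a drop per factor 64 in k is already of the required order.
    coarse : 1# ≤ ε * fromℕ 128 → c * root 2 (ε ⁻¹) * log₂ n ≤ fromℕ (size D)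
    coarse 1≤128ε =
      -- As 4096 = 64², the assumption on n says exactly that the window from 1 to 64 fits.
      let T , reached , exceeded = last-scale 1 64 n (s≤s z≤n) (s≤s (s≤s z≤n)) 4096≤n
          m = suc (suc T)
      in c*√ε⁻¹*log₂≤ {n = n} 12 (6 ℕ.* m ℕ.+ 6 ℕ.* m) (suc T ℕ.* 1)
        (√ε⁻¹≤ 128 12 0<ε 1≤128ε (ℕₚ.m≤m+n 128 16))
        (log₂≤ (6 ℕ.* m ℕ.+ 6 ℕ.* m) (ℕₚ.≤-trans exceeded (ℕₚ.≤-reflexive (Arithmetic.[1*b^m]²≡2^[em+em] 6 m ≡.refl))))
        (Arithmetic.coarse-constant T)
        (coarse-size-bound 0<ε 2ε<1 D D-coreset 2ε≤1 (suc T) reached)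
      where
      2ε≤1 : ε * fromℕ 2 ≤ 1#
      2ε≤1 = ≤-trans (≤-reflexive (solve 1 (λ ε → ε :* (con 1 :+ (con 1 :+ con 0)) := ε :+ ε) refl ε)) (proj₁ 2ε<1)

    -- The failure at w + 1 bounds √(1/ε) by 23w, while each of the T + 1 doubling blocks
    -- contributes w drops; the factor w then appears on both sides.
    fine : ∀ w → 1 ℕ.≤ w → ε * fromℕ (128 ℕ.* (w ℕ.* w)) ≤ 1# →
      1# ≤ ε * fromℕ (128 ℕ.* (suc w ℕ.* suc w)) → c * root 2 (ε ⁻¹) * log₂ n ≤ fromℕ (size D)
    fine w 1≤w 128εw²≤1 1≤128ε[1+w]² =
      let u = 128 ℕ.* (w ℕ.* w)
          n≥u³ = u³≤n n u 0<ε 1<ε³n 128εw²≤1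
          T , reached , exceeded = last-scale (2 ℕ.* w) 2 n (ℕₚ.≤-trans 1≤w (ℕₚ.m≤m+n w _)) (s≤s (s≤s z≤n))
            (ℕₚ.≤-trans (Arithmetic.[2w*2^1]²≤u³ 1≤w) n≥u³)
          m = suc (suc T)
      in c*√ε⁻¹*log₂≤ {n = n} (23 ℕ.* w) (m ℕ.* 3) (suc T ℕ.* w)
        (√ε⁻¹≤ (128 ℕ.* (suc w ℕ.* suc w)) (23 ℕ.* w) 0<ε 1≤128ε[1+w]² (Arithmetic.128[1+w]²≤[23w]² 1≤w))
        (log₂≤ (m ℕ.* 3) (Arithmetic.n≤2^[S*3] w m 1≤n n≥u³ exceeded))
        (Arithmetic.fine-constant T w)
        (fine-size-bound 0<ε 2ε<1 D D-coreset w 1≤w 128εw²≤1 (suc T) reached)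

    -- For w the largest integer with 128εw² ≤ 1, √(1/ε) has the order of w unless w = 0,
    -- where a single window per factor 64 suffices.
    size-bound : c * root 2 (ε ⁻¹) * log₂ n ≤ fromℕ (size D)
    size-bound = by-search (bounded-search P? n P0 ¬Pn)
      where
      P : ℕ → Set
      P w = ε * fromℕ (128 ℕ.* (w ℕ.* w)) ≤ 1#
      P? : Decidable P
      P? w = ε * fromℕ (128 ℕ.* (w ℕ.* w)) ≤? 1#
      P0 : P 0
      P0 = ≤-trans (≤-reflexive (zeroʳ ε)) 0≤1
      ¬Pn : ¬ P n
      ¬Pn = <⇒≱ (1<128εn² 0<ε (≤-trans (x≤x+y ε (proj₁ 0<ε)) (proj₁ 2ε<1)) 1≤n 1<ε³n)
      by-search : ∃[ w ] P w × ¬ P (suc w) → c * root 2 (ε ⁻¹) * log₂ n ≤ fromℕ (size D)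
      by-search (zero      , _  , ¬P1)   = coarse (proj₁ (≰⇒< ¬P1))
      by-search (w@(suc _) , Pw , ¬P1+w) = fine w (s≤s z≤n) Pw (proj₁ (≰⇒< ¬P1+w))

theorem4p9 : (ℝ : RealNumbers) → let open Centrum ℝ in
    Σ[ c ∈ Carrier ] Σ[ n₀ ∈ ℕ ] 0# < c ×
    (∀ (n : ℕ) → n₀ ℕ.≤ n →
    ∀ (ε : Carrier) → root 3 ((fromℕ n) ⁻¹) < ε → ε < (fromℕ 2) ⁻¹ →
    Σ[ X ∈ List Carrier ] Unique X × length X ≡ n ×
    (∀ (D : WeightedSet) → IsSimultaneousCoreset ε X D →
    c * root 2 (ε ⁻¹) * log₂ n ≤ fromℕ (size D)))
theorem4p9 ℝ = c , 4096 , ⁻¹-pos 0<288 , λ n 4096≤n ε root<ε ε<½ →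
  let 0<ε , 1<ε³n = 0<ε∧nε³>1 (ℕₚ.≤-trans (s≤s z≤n) 4096≤n) root<ε in
  applyUpTo √Δ n , unique-√Δ n , Listₚ.length-applyUpTo √Δ n ,
  size-bound 4096≤n 0<ε (ε<½⇒ε+ε<1 ε<½) 1<ε³n
  where
  open LowerBound ℝ
  open OrderedField ℝ using (⁻¹-pos)
  open Roots ℝ using (√Δ; 0<ε∧nε³>1)
  open PrefixSums ℝ using (unique-√Δ)
  open Windows ℝ using (ε<½⇒ε+ε<1)
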